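{- There is an absolute constant $C>0$ such that for every $d\ge1$, every $p\in[1,\infty]$ and every $\epsilon\in(0,1)$ there exists a one-sided, non-adaptive $(\epsilon,\ell_p)$-tester for real symmetric $d\times d$ matrices that makes at most $C\,\frac{1}{\epsilon^2}d^{2-2/p}$ vector-matrix-vector queries (with $1/p=0$ for $p=\infty$).
   Context: For a real symmetric matrix $A$, $\|A\|_p$ denotes the Schatten-$p$ norm (the $\ell_p$ norm of the vector of singular values; $\|A\|_\infty$ is the operator norm), and $\lambda_{\min}(A)$ its smallest eigenvalue. PSD means positive semidefinite. A randomized algorithm has access to an unknown real symmetric $d\times d$ matrix $A$ only through vector-matrix-vector queries: it chooses $v,w\in\mathbb{R}^d$ and receives $v^TAw$. It is non-adaptive if all query vectors are chosen (possibly at random) before any answer is received. Computation is otherwise free; the number of queries is counted in the worst case over inputs and coins. For $p\in[1,\infty]$ and $\epsilon\in(0,1)$, an $(\epsilon,\ell_p)$-tester is such an algorithm that outputs True with probability at least $2/3$ if $A$ is PSD, and outputs False with probability at least $2/3$ if $A\neq 0$ and $\lambda_{\min}(A)\le-\epsilon\|A\|_p$. The tester is one-sided if on every PSD input it outputs True for every outcome of its random coins. -}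

module Defs where

open import Level using (0ℓ)
open import Algebra.Bundles using (CommutativeRing)
open import Algebra.Structures using (IsCommutativeRing)
open import Data.Bool.Base using (Bool; true; false; if_then_else_)
open import Data.Fin.Base using (Fin; toℕ)
open import Data.Fin.Properties using (_≟_)
open import Data.Nat.Base as ℕ using (ℕ)
open import Data.Product.Base using (Σ-syntax; ∃; ∃-syntax; _×_; _,_; proj₁; proj₂)
open import Data.Sum.Base using (_⊎_)
open import Data.Vec.Functional using (Vector; map; foldr)
open import Relation.Binary.Bundles using (TotalOrder)
open import Relation.Binary.Core using (Rel)
open import Relation.Binary.PropositionalEquality.Core using (_≡_; _≢_)
open import Relation.Binary.Structures using (IsTotalOrder)
open import Relation.Nullary.Decidable.Core using (does)
open import Relation.Nullary.Negation.Core using (¬_)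
open import Relation.Unary using (Pred; U; ∁; ⋃; _≐_; _⊥_)

-- The real numbers, characterised up to isomorphism as a Dedekind-complete
-- ordered field.  _⁻¹ and sup are total: nothing is assumed about 0# ⁻¹, nor
-- about the supremum of an empty or unbounded predicate.
record RealNumbers : Set₁ where
  infix  4 _≈_ _≤_
  infixl 6 _+_
  infixl 7 _*_
  infix  8 -_
  infix  9 _⁻¹
  field
    Carrier           : Set
    _≈_ _≤_           : Rel Carrier 0ℓ
    _+_ _*_           : Carrier → Carrier → Carrier
    -_ _⁻¹            : Carrier → Carrier
    0# 1#             : Carrier
    isCommutativeRing : IsCommutativeRing _≈_ _+_ _*_ -_ 0# 1#
    0≉1               : ¬ 0# ≈ 1#
    ⁻¹-inverseʳ       : ∀ x → ¬ x ≈ 0# → x * x ⁻¹ ≈ 1#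
    isTotalOrder      : IsTotalOrder _≈_ _≤_
    +-monoˡ-≤         : ∀ z {x y} → x ≤ y → x + z ≤ y + z
    *-nonneg          : ∀ {x y} → 0# ≤ x → 0# ≤ y → 0# ≤ x * y

  IsUpperBound : Pred Carrier 0ℓ → Carrier → Set
  IsUpperBound P b = ∀ x → P x → x ≤ b

  IsSupremum : Pred Carrier 0ℓ → Carrier → Set
  IsSupremum P s = IsUpperBound P s × (∀ b → IsUpperBound P b → s ≤ b)

  field
    sup            : Pred Carrier 0ℓ → Carrier
    sup-isSupremum : ∀ P → ∃ P → ∃ (IsUpperBound P) → IsSupremum P (sup P)

  commutativeRing : CommutativeRing 0ℓ 0ℓ
  commutativeRing = record { isCommutativeRing = isCommutativeRing }

  totalOrder : TotalOrder 0ℓ 0ℓ 0ℓ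
  totalOrder = record { isTotalOrder = isTotalOrder }

  open import Relation.Binary.Construct.NonStrictToStrict _≈_ _≤_ public
    using (_<_)

module Testing (R : RealNumbers) where

  open RealNumbers R public renaming (Carrier to ℝ)
  open CommutativeRing commutativeRing public
    using (_-_; semiring; +-commutativeMonoid; setoid)
  open import Algebra.Construct.NaturalChoice.Max totalOrder public
    using (_⊔_)
  open import Algebra.Properties.CommutativeMonoid.Sum +-commutativeMonoid public
    using (sum; sum-syntax)
  open import Algebra.Properties.Semiring.Exp semiring public
    using (_^_)
  open import Algebra.Properties.Semiring.Mult semiring public
    using () renaming (_×_ to _·_)
  open import Data.Vec.Functional.Relation.Binary.Equality.Setoid setoid public
    using (_≋_)

  infixr 9 _^ʳ_
  infixl 7 _∙_ _*ᵥ_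

  fromℕ : ℕ → ℝ
  fromℕ n = n · 1#

  ∣_∣ : ℝ → ℝ
  ∣ x ∣ = x ⊔ - x

  -- For 0 ≤ z, the condition z ^ b ≤ x ^ a says z ≤ x^(a/b).  The rational
  -- powers x^q increase with q when 1 ≤ x and decrease when x ≤ 1, so x^r is
  -- approached from below by exponents q ≤ r, respectively r ≤ q.
  BelowPower : ℝ → ℝ → Pred ℝ 0ℓ
  BelowPower x r z =
    0# ≤ z ×
    (Σ[ a ∈ ℕ ] Σ[ b ∈ ℕ ]
      1 ℕ.≤ b ×
      ((1# ≤ x × fromℕ a ≤ r * fromℕ b) ⊎ (x ≤ 1# × r * fromℕ b ≤ fromℕ a)) ×
      z ^ b ≤ x ^ a)

  -- The real power x^r, for base 0 ≤ x and exponent 0 ≤ r only.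
  _^ʳ_ : ℝ → ℝ → ℝ
  x ^ʳ r = sup (BelowPower x r)

  data Exponent : Set where
    finite : (p : ℝ) → 1# ≤ p → Exponent
    ∞      : Exponent

  recip : Exponent → ℝ
  recip (finite p _) = p ⁻¹
  recip ∞            = 0#

  ℓ-norm : ∀ {n} → Exponent → Vector ℝ n → ℝ
  ℓ-norm {n} (finite p _) x = (∑[ i < n ] (∣ x i ∣ ^ʳ p)) ^ʳ (p ⁻¹)
  ℓ-norm ∞                x = foldr _⊔_ 0# (map ∣_∣ x)

  Matrix : ℕ → Set
  Matrix d = Fin d → Fin d → ℝ

  _∙_ : ∀ {d} → Vector ℝ d → Vector ℝ d → ℝ
  _∙_ {d} v w = ∑[ i < d ] (v i * w i)

  _*ᵥ_ : ∀ {d} → Matrix d → Vector ℝ d → Vector ℝ d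
  (A *ᵥ v) i = A i ∙ v

  identity : ∀ {d} → Matrix d
  identity i j = if does (i ≟ j) then 1# else 0#

  IsSymmetric : ∀ {d} → Matrix d → Set
  IsSymmetric A = ∀ i j → A i j ≈ A j i

  IsZero : ∀ {d} → Matrix d → Set
  IsZero A = ∀ i j → A i j ≈ 0#

  IsPSD : ∀ {d} → Matrix d → Set
  IsPSD {d} A = (v : Vector ℝ d) → 0# ≤ v ∙ (A *ᵥ v)

  IsOrthogonal : ∀ {d} → Matrix d → Set
  IsOrthogonal {d} Q =
    (∀ i j → ∑[ k < d ] (Q k i * Q k j) ≈ identity i j) ×
    (∀ i j → ∑[ k < d ] (Q i k * Q j k) ≈ identity i j)

  -- σ lists the singular values of A, in any order: A = P diag(σ) Qᵀ.
  AreSingularValues : ∀ {d} → Matrix d → Vector ℝ d → Set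
  AreSingularValues {d} A σ =
    (∀ k → 0# ≤ σ k) ×
    (∃[ P ] ∃[ Q ]
      IsOrthogonal P × IsOrthogonal Q ×
      (∀ i j → A i j ≈ ∑[ k < d ] (P i k * σ k * Q j k)))

  IsSchattenNorm : ∀ {d} → Exponent → Matrix d → ℝ → Set
  IsSchattenNorm p A s = ∃[ σ ] AreSingularValues A σ × s ≈ ℓ-norm p σ

  IsEigenvalue : ∀ {d} → Matrix d → ℝ → Set
  IsEigenvalue {d} A l =
    Σ[ v ∈ Vector ℝ d ]
      ¬ (∀ i → v i ≈ 0#) × (A *ᵥ v) ≋ (λ i → l * v i)

  IsSmallestEigenvalue : ∀ {d} → Matrix d → ℝ → Set
  IsSmallestEigenvalue A l =
    IsEigenvalue A l × (∀ l′ → IsEigenvalue A l′ → l ≤ l′)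

  -- μ is meaningful only on events.  Since its values there are nonnegative,
  -- the sum of a series of them is the supremum of the partial sums.
  record ProbabilitySpace : Set₁ where
    field
      Ω       : Set
      IsEvent : Pred Ω 0ℓ → Set
      μ       : Pred Ω 0ℓ → ℝ

      event-resp : ∀ {E F} → E ≐ F → IsEvent E → IsEvent F
      event-U    : IsEvent U
      event-∁    : ∀ {E} → IsEvent E → IsEvent (∁ E)
      event-⋃    : ∀ (E : ℕ → Pred Ω 0ℓ) → (∀ n → IsEvent (E n)) →
                   IsEvent (⋃ ℕ E)

      μ-resp     : ∀ {E F} → E ≐ F → IsEvent E → μ E ≈ μ F
      μ-nonneg   : ∀ {E} → IsEvent E → 0# ≤ μ E
      μ-U        : μ U ≈ 1#
      μ-⋃        : ∀ (E : ℕ → Pred Ω 0ℓ) → (∀ n → IsEvent (E n)) →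
                   (∀ m n → m ≢ n → E m ⊥ E n) →
                   IsSupremum
                     (λ s → Σ[ n ∈ ℕ ] s ≈ ∑[ i < n ] μ (E (toℕ i)))
                     (μ (⋃ ℕ E))

  -- A coin outcome ω fixes all queries before any answer is seen.  The output
  -- may depend on the answers only as real numbers (decide-cong), and on ω.
  record NonAdaptiveAlgorithm (d : ℕ) : Set₁ where
    field
      coins : ProbabilitySpace

    open ProbabilitySpace coins public

    field
      #queries    : Ω → ℕ
      queries     : (ω : Ω) → Vector (Vector ℝ d × Vector ℝ d) (#queries ω)
      decide      : (ω : Ω) → Vector ℝ (#queries ω) → Bool
      decide-cong : ∀ ω {x y} → x ≋ y → decide ω x ≡ decide ω y

    answers : (A : Matrix d) (ω : Ω) → Vector ℝ (#queries ω)
    answers A ω = map (λ q → proj₁ q ∙ (A *ᵥ proj₂ q)) (queries ω)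

    output : Matrix d → Ω → Bool
    output A ω = decide ω (answers A ω)

    Outputs : Matrix d → Bool → Pred Ω 0ℓ
    Outputs A b ω = output A ω ≡ b

    field
      output-measurable : ∀ A → IsSymmetric A → ∀ b → IsEvent (Outputs A b)

  module _ {d : ℕ} (T : NonAdaptiveAlgorithm d) where

    open NonAdaptiveAlgorithm T

    record IsTester (ε : ℝ) (p : Exponent) : Set where
      field
        accepts-PSD : ∀ A → IsSymmetric A → IsPSD A →
                      fromℕ 2 * fromℕ 3 ⁻¹ ≤ μ (Outputs A true)
        rejects-far : ∀ A → IsSymmetric A → ¬ IsZero A →
                      ∀ l s → IsSmallestEigenvalue A l → IsSchattenNorm p A s →
                      l ≤ - (ε * s) →
                      fromℕ 2 * fromℕ 3 ⁻¹ ≤ μ (Outputs A false)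

    IsOneSided : Set
    IsOneSided = ∀ A → IsSymmetric A → IsPSD A → ∀ ω → output A ω ≡ true

    MakesAtMost : ℝ → Set
    MakesAtMost q = ∀ ω → fromℕ (#queries ω) ≤ q

module Submission where

-- Take k random sign vectors g₁, …, gₖ ∈ {±1}ᵈ, query all gₐᵀ A g_b, and reject iff the k × k
-- answer matrix has a negative direction; this never happens when A is PSD.  If A v = l v with
-- |v| = 1 and l < 0, test the direction y = Σⱼ ⟨gⱼ,v⟩ gⱼ.  Its component along v is
-- α = Σⱼ ⟨gⱼ,v⟩², with mean k and variance at most 2k, so it contributes about l k² to yᵀ A y.
-- For u ⊥ v the variable ⟨u,y⟩ is a sum of k independent centred terms, so its second moment is
-- at most k |u|²; by a singular value decomposition of A the rest w = y − α v contributes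
-- |wᵀ A w| ≤ k ‖A‖₁ on average (the cross terms vanish).  Hence k of order ‖A‖₁ / (ε ‖A‖ₚ)
-- suffices, and ‖A‖₁ ≤ d^(1−1/p) ‖A‖ₚ up to a constant.
--
-- The last inequality is proved for exponents a/b close to p, where it is a weighted AM–GM
-- inequality between integer powers.  The error of rounding p is absorbed in a constant factor, so
-- all that is needed about real powers is x^a ≤ (x^r)^b when a/b is on the correct side of r.

-- The query bound is `d^(2 - 2/p)` up to constants, and `k²` answers are used. So the norm
-- comparison is proved in squared form, `‖A‖₁² ≤ 256 ‖A‖ₚ² d^(2 - 2/p)`, and `k²` is picked
-- directly within a factor 4 of its target. The obstacle with real powers is that the correct side
-- of `r` changes when the base crosses 1. The singular values and their power sum can lie on both
-- sides, so no single `a/b` serves all of them. Rounding to the wrong side costs one further factor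
-- of the base or of the power; a large `b` turns it into a constant, because the final inequality
-- is read after taking a-th roots with `a ≥ b`. Normalising the eigenvector would take a square
-- root. Its squared length `n` is carried through all moments instead and cancels as `n³` at the
-- end. Sign vectors keep the probability space finite: expectations are iterated averages over two
-- values, and every predicate can serve as an event.

open import Defs
open import Level using (0ℓ)
open import Axiom.ExcludedMiddle using (ExcludedMiddle)
open import Algebra.Bundles using (CommutativeRing; RawRing)
open import Algebra.Solver.Ring.AlmostCommutativeRing
  using (fromCommutativeRing; _-Raw-AlmostCommutative⟶_)
open import Data.Bool.Base using (if_then_else_; Bool; true; false; not)
open import Data.Fin.Base using (zero; suc; Fin; toℕ; remQuot; combine)
open import Data.Fin.Properties using (remQuot-combine; _≟_)
open import Data.Integer.Base as ℤ using (ℤ; +_; -[1+_])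
import Data.Integer.Properties as ℤ
open import Data.Maybe.Base as Maybe using (Maybe)
open import Data.Nat.Base as ℕ using (ℕ; zero; suc; z≤n; s≤s)
import Data.Nat.Properties as ℕ
open import Data.Product.Base using (Σ-syntax; _×_; _,_; proj₁; proj₂)
open import Data.Sum.Base using (inj₁; inj₂; _⊎_)
open import Data.Unit.Base using (⊤; tt)
open import Data.Vec.Base using (Vec; []; _∷_; lookup)
open import Data.Vec.Functional using (Vector; foldr; map)
open import Function.Base using (_∘_)
open import Relation.Binary.Bundles using (Poset)
open import Relation.Binary.Consequences using (dec⇒weaklyDec)
open import Relation.Binary.PropositionalEquality.Core as ≡ using (_≡_; _≢_)
open import Relation.Binary.Structures using (IsTotalOrder)
open import Relation.Nullary.Decidable.Core using (yes; no; decidable-stable; does; Dec)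
open import Relation.Nullary.Negation.Core using (¬_; contradiction)
open import Relation.Unary using (Pred; _⊥_; ⋃)

-- A ring solver for `ℝ` with integer coefficients.

module RingSolver (R : RealNumbers) where

  open Testing R
  open CommutativeRing commutativeRing public
    using ( refl; sym; trans; reflexive; +-cong; +-congˡ; +-congʳ; *-cong; *-congˡ; *-congʳ; -‿cong
          ; +-identityˡ; +-identityʳ; *-identityˡ; *-identityʳ; +-comm; *-comm; +-assoc; *-assoc
          ; zeroˡ; zeroʳ; -‿inverseʳ; ring)
  open import Algebra.Properties.Ring ring using (-0#≈0#; -‿involutive; -‿distribˡ-*; -‿distribʳ-*; -‿+-comm)
  import Algebra.Properties.Semiring.Mult.TCOptimised semiring as Mult′
  open import Algebra.Properties.Semiring.Exp semiring public using (^-congˡ; ^-homo-*; ^-assocʳ)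
  open IsTotalOrder isTotalOrder public
    using (total)
    renaming (refl to ≤-refl; reflexive to ≤-reflexive; trans to ≤-trans; antisym to ≤-antisym)

  ≤-poset : Poset 0ℓ 0ℓ 0ℓ
  ≤-poset = record { isPartialOrder = IsTotalOrder.isPartialOrder isTotalOrder }

  module ≤-R where
    open import Relation.Binary.Reasoning.PartialOrder ≤-poset public

  private
    -- Coefficients are integers because the solver needs a test of their equality in order to
    -- cancel terms. With the optimised multiples `⟦ + 1 ⟧ℤ` is `1#` by definition.
    ⟦_⟧ℤ : ℤ → ℝ
    ⟦ + n ⟧ℤ      = n Mult′.× 1#
    ⟦ -[1+ n ] ⟧ℤ = - (suc n Mult′.× 1#)

    open import Relation.Binary.Reasoning.Setoid setoid

    ⊖-homo : ∀ m n → ⟦ m ℤ.⊖ n ⟧ℤ ≈ m Mult′.× 1# - n Mult′.× 1#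
    ⊖-homo zero    zero    = sym (-‿inverseʳ 0#)
    ⊖-homo zero    (suc n) = sym (+-identityˡ _)
    ⊖-homo (suc m) zero    = sym (trans (+-congˡ -0#≈0#) (+-identityʳ _))
    ⊖-homo (suc m) (suc n) = begin
      ⟦ suc m ℤ.⊖ suc n ⟧ℤ                      ≡⟨ ≡.cong ⟦_⟧ℤ (ℤ.[1+m]⊖[1+n]≡m⊖n m n) ⟩
      ⟦ m ℤ.⊖ n ⟧ℤ                              ≈⟨ ⊖-homo m n ⟩
      x - y                                     ≈⟨ +-identityˡ _ ⟨
      0# + (x - y)                              ≈⟨ +-congʳ (-‿inverseʳ 1#) ⟨
      (1# - 1#) + (x - y)                       ≈⟨ +-assoc _ _ _ ⟩
      1# + (- 1# + (x - y))                     ≈⟨ +-congˡ (+-assoc _ _ _) ⟨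
      1# + ((- 1# + x) - y)                     ≈⟨ +-congˡ (+-congʳ (+-comm _ _)) ⟩
      1# + ((x - 1#) - y)                       ≈⟨ +-congˡ (+-assoc _ _ _) ⟩
      1# + (x + (- 1# - y))                     ≈⟨ +-assoc _ _ _ ⟨
      (1# + x) + (- 1# - y)                     ≈⟨ +-cong (Mult′.×-homo-+ 1# 1 m) (-1-suc n) ⟨
      suc m Mult′.× 1# - suc n Mult′.× 1#       ∎
      where
      x = m Mult′.× 1#
      y = n Mult′.× 1#
      -1-suc : ∀ n → - (suc n Mult′.× 1#) ≈ - 1# - n Mult′.× 1#
      -1-suc n = trans (-‿cong (Mult′.×-homo-+ 1# 1 n)) (sym (-‿+-comm _ _))

    ℤ-+-homo : ∀ i j → ⟦ i ℤ.+ j ⟧ℤ ≈ ⟦ i ⟧ℤ + ⟦ j ⟧ℤ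
    ℤ-+-homo (+ m)    (+ n)    = Mult′.×-homo-+ 1# m n
    ℤ-+-homo (+ m)    -[1+ n ] = ⊖-homo m (suc n)
    ℤ-+-homo -[1+ m ] (+ n)    = trans (⊖-homo n (suc m)) (+-comm _ _)
    ℤ-+-homo -[1+ m ] -[1+ n ] = trans
      (-‿cong (trans (reflexive (≡.cong (λ j → suc j Mult′.× 1#) (≡.sym (ℕ.+-suc m n))))
                     (Mult′.×-homo-+ 1# (suc m) (suc n))))
      (sym (-‿+-comm _ _))

    neg-homo : ∀ i → ⟦ ℤ.- i ⟧ℤ ≈ - ⟦ i ⟧ℤ
    neg-homo (+ zero)  = sym -0#≈0#
    neg-homo (+ suc n) = refl
    neg-homo -[1+ n ]  = sym (-‿involutive _)

    ℤ-*-homo : ∀ i j → ⟦ i ℤ.* j ⟧ℤ ≈ ⟦ i ⟧ℤ * ⟦ j ⟧ℤ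
    ℤ-*-homo (+ m) (+ n) = trans (reflexive (≡.cong ⟦_⟧ℤ (≡.sym (ℤ.pos-* m n)))) (Mult′.×1-homo-* m n)
    ℤ-*-homo (+ m) -[1+ n ] = begin
      ⟦ + m ℤ.* -[1+ n ] ⟧ℤ        ≡⟨ ≡.cong ⟦_⟧ℤ (ℤ.neg-distribʳ-* (+ m) (+ suc n)) ⟨
      ⟦ ℤ.- (+ m ℤ.* + suc n) ⟧ℤ   ≈⟨ neg-homo (+ m ℤ.* + suc n) ⟩
      - ⟦ + m ℤ.* + suc n ⟧ℤ       ≈⟨ -‿cong (ℤ-*-homo (+ m) (+ suc n)) ⟩
      - (⟦ + m ⟧ℤ * ⟦ + suc n ⟧ℤ)  ≈⟨ -‿distribʳ-* _ _ ⟩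
      ⟦ + m ⟧ℤ * - ⟦ + suc n ⟧ℤ    ∎
    ℤ-*-homo -[1+ m ] (+ n) = begin
      ⟦ -[1+ m ] ℤ.* + n ⟧ℤ        ≡⟨ ≡.cong ⟦_⟧ℤ (ℤ.neg-distribˡ-* (+ suc m) (+ n)) ⟨
      ⟦ ℤ.- (+ suc m ℤ.* + n) ⟧ℤ   ≈⟨ neg-homo (+ suc m ℤ.* + n) ⟩
      - ⟦ + suc m ℤ.* + n ⟧ℤ       ≈⟨ -‿cong (ℤ-*-homo (+ suc m) (+ n)) ⟩
      - (⟦ + suc m ⟧ℤ * ⟦ + n ⟧ℤ)  ≈⟨ -‿distribˡ-* _ _ ⟩
      - ⟦ + suc m ⟧ℤ * ⟦ + n ⟧ℤ    ∎
    ℤ-*-homo -[1+ m ] -[1+ n ] = begin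
      ⟦ + (suc m ℕ.* suc n) ⟧ℤ           ≈⟨ Mult′.×1-homo-* (suc m) (suc n) ⟩
      ⟦ + suc m ⟧ℤ * ⟦ + suc n ⟧ℤ         ≈⟨ -‿involutive _ ⟨
      - - (⟦ + suc m ⟧ℤ * ⟦ + suc n ⟧ℤ)   ≈⟨ -‿cong (-‿distribˡ-* _ _) ⟩
      - (- ⟦ + suc m ⟧ℤ * ⟦ + suc n ⟧ℤ)   ≈⟨ -‿distribʳ-* _ _ ⟩
      - ⟦ + suc m ⟧ℤ * - ⟦ + suc n ⟧ℤ     ∎

    ℤ-rawRing : RawRing 0ℓ 0ℓ
    ℤ-rawRing = record
      { Carrier = ℤ ; _≈_ = _≡_ ; _+_ = ℤ._+_ ; _*_ = ℤ._*_ ; -_ = ℤ.-_ ; 0# = + 0 ; 1# = + 1 }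

    ℤ-morphism : ℤ-rawRing -Raw-AlmostCommutative⟶ fromCommutativeRing commutativeRing
    ℤ-morphism = record
      { ⟦_⟧ = ⟦_⟧ℤ ; +-homo = ℤ-+-homo ; *-homo = ℤ-*-homo ; -‿homo = neg-homo
      ; 0-homo = refl ; 1-homo = refl }

    ℤ-dec : ∀ i j → Maybe (⟦ i ⟧ℤ ≈ ⟦ j ⟧ℤ)
    ℤ-dec i j = Maybe.map (λ eq → reflexive (≡.cong ⟦_⟧ℤ eq)) (dec⇒weaklyDec ℤ._≟_ i j)

  module Solver where
    open import Algebra.Solver.Ring ℤ-rawRing
        (fromCommutativeRing commutativeRing) ℤ-morphism ℤ-dec public
      using (Polynomial; con; solve; _:=_; _:+_; _:*_; _:-_; :-_; _:^_)

    :0 :1 : ∀ {n} → Polynomial n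
    :0 = con (+ 0)
    :1 = con (+ 1)

    -- A numeral is spelled out as a sum of ones so that it evaluates to `fromℕ n` by definition;
    -- `con (+ n)` would evaluate to a differently bracketed sum.
    :ℕ : ∀ {m} → ℕ → Polynomial m
    :ℕ zero    = :0
    :ℕ (suc n) = :1 :+ :ℕ n

-- Ordered field arithmetic, integer powers and the Archimedean property.

module OrderedField (em : ExcludedMiddle 0ℓ) (R : RealNumbers) where

  open Testing R
  open RingSolver R
  open import Algebra.Properties.Semiring.Mult semiring using (×1-homo-*; ×-homo-+)

  open Solver

  private variable
    x y z w : ℝ
    m n : ℕ

  -- Polynomial inequalities below are mostly brought to this form: a nonnegative gap `g` is
  -- exhibited, and the ring solver checks the identity.
  ≤-gap : ∀ g → y ≈ x + g → 0# ≤ g → x ≤ y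
  ≤-gap {y} {x} g y≈x+g 0≤g = begin
    x       ≈⟨ +-identityˡ x ⟨
    0# + x  ≤⟨ +-monoˡ-≤ x 0≤g ⟩
    g + x   ≈⟨ +-comm g x ⟩
    x + g   ≈⟨ y≈x+g ⟨
    y       ∎
    where open ≤-R

  ≤⇒0≤- : x ≤ y → 0# ≤ y - x
  ≤⇒0≤- {x} {y} x≤y = begin
    0#     ≈⟨ -‿inverseʳ x ⟨
    x - x  ≤⟨ +-monoˡ-≤ (- x) x≤y ⟩
    y - x  ∎
    where open ≤-R

  0≤-⇒≤ : 0# ≤ y - x → x ≤ y
  0≤-⇒≤ {y} {x} = ≤-gap (y - x) (solve 2 (λ x y → y := x :+ (y :- x)) refl x y)

  +-mono-≤ : x ≤ y → z ≤ w → x + z ≤ y + w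
  +-mono-≤ {x} {y} {z} {w} x≤y z≤w = begin
    x + z  ≤⟨ +-monoˡ-≤ z x≤y ⟩
    y + z  ≈⟨ +-comm y z ⟩
    z + y  ≤⟨ +-monoˡ-≤ y z≤w ⟩
    w + y  ≈⟨ +-comm w y ⟩
    y + w  ∎
    where open ≤-R

  +-monoʳ-≤ : ∀ z → x ≤ y → z + x ≤ z + y
  +-monoʳ-≤ z = +-mono-≤ ≤-refl

  +-nonneg : 0# ≤ x → 0# ≤ y → 0# ≤ x + y
  +-nonneg 0≤x 0≤y = ≤-trans (≤-reflexive (sym (+-identityˡ 0#))) (+-mono-≤ 0≤x 0≤y)

  *-monoˡ-≤ : 0# ≤ z → x ≤ y → z * x ≤ z * y
  *-monoˡ-≤ {z} {x} {y} 0≤z x≤y = ≤-gap (z * (y - x))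
    (solve 3 (λ x y z → z :* y := z :* x :+ z :* (y :- x)) refl x y z)
    (*-nonneg 0≤z (≤⇒0≤- x≤y))

  *-monoʳ-≤ : 0# ≤ z → x ≤ y → x * z ≤ y * z
  *-monoʳ-≤ 0≤z x≤y = begin
    _ ≈⟨ *-comm _ _ ⟩
    _ ≤⟨ *-monoˡ-≤ 0≤z x≤y ⟩
    _ ≈⟨ *-comm _ _ ⟩
    _ ∎
    where open ≤-R

  *-mono-≤ : 0# ≤ x → 0# ≤ z → x ≤ y → z ≤ w → x * z ≤ y * w
  *-mono-≤ 0≤x 0≤z x≤y z≤w =
    ≤-trans (*-monoʳ-≤ 0≤z x≤y) (*-monoˡ-≤ (≤-trans 0≤x x≤y) z≤w)

  neg-mono-≤ : x ≤ y → - y ≤ - x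
  neg-mono-≤ {x} {y} x≤y = ≤-gap (y - x)
    (solve 2 (λ x y → :- x := :- y :+ (y :- x)) refl x y) (≤⇒0≤- x≤y)

  ≤0⇒0≤neg : x ≤ 0# → 0# ≤ - x
  ≤0⇒0≤neg {x} x≤0 = ≤-trans (≤⇒0≤- x≤0) (≤-reflexive (+-identityˡ _))

  square-nonneg : ∀ x → 0# ≤ x * x
  square-nonneg x with total 0# x
  ... | inj₁ 0≤x = *-nonneg 0≤x 0≤x
  ... | inj₂ x≤0 = ≤-trans (*-nonneg 0≤-x 0≤-x)
                     (≤-reflexive (solve 1 (λ x → :- x :* :- x := x :* x) refl x))
    where 0≤-x = ≤0⇒0≤neg x≤0

  0≤1 : 0# ≤ 1#
  0≤1 = ≤-trans (square-nonneg 1#) (≤-reflexive (*-identityˡ 1#))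

  0<1 : 0# < 1#
  0<1 = 0≤1 , 0≉1

  ≰⇒> : ¬ x ≤ y → y < x
  ≰⇒> {x} {y} x≰y with total x y
  ... | inj₁ x≤y = contradiction x≤y x≰y
  ... | inj₂ y≤x = y≤x , λ y≈x → x≰y (≤-reflexive (sym y≈x))

  ≮⇒≥ : ¬ y < x → x ≤ y
  ≮⇒≥ y≮x = decidable-stable em λ x≰y → y≮x (≰⇒> x≰y)

  <⇒≱ : x < y → ¬ y ≤ x
  <⇒≱ (x≤y , x≉y) y≤x = x≉y (≤-antisym x≤y y≤x)

  <-≤-trans : x < y → y ≤ z → x < z
  <-≤-trans x<y y≤z = ≤-trans (proj₁ x<y) y≤z ,
    λ x≈z → <⇒≱ x<y (≤-trans y≤z (≤-reflexive (sym x≈z)))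

  ≤-<-trans : x ≤ y → y < z → x < z
  ≤-<-trans x≤y y<z = ≤-trans x≤y (proj₁ y<z) ,
    λ x≈z → <⇒≱ y<z (≤-trans (≤-reflexive (sym x≈z)) x≤y)

  pos⇒≉0 : 0# < x → ¬ x ≈ 0#
  pos⇒≉0 (_ , 0≉x) x≈0 = 0≉x (sym x≈0)

  0≤⇒0<⊎≈0 : 0# ≤ x → 0# < x ⊎ x ≈ 0#
  0≤⇒0<⊎≈0 {x} 0≤x with em {x ≈ 0#}
  ... | yes x≈0 = inj₂ x≈0
  ... | no  x≉0 = inj₁ (0≤x , x≉0 ∘ sym)

  x*y≈0⇒y≈0 : ¬ x ≈ 0# → x * y ≈ 0# → y ≈ 0#
  x*y≈0⇒y≈0 {x} {y} x≉0 xy≈0 = begin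
    y                 ≈⟨ *-identityˡ y ⟨
    1# * y            ≈⟨ *-congʳ (⁻¹-inverseʳ x x≉0) ⟨
    x * x ⁻¹ * y      ≈⟨ solve 3 (λ x i y → x :* i :* y := i :* (x :* y)) refl x (x ⁻¹) y ⟩
    x ⁻¹ * (x * y)    ≈⟨ *-congˡ xy≈0 ⟩
    x ⁻¹ * 0#         ≈⟨ zeroʳ _ ⟩
    0#                ∎
    where open import Relation.Binary.Reasoning.Setoid setoid

  *-pos : 0# < x → 0# < y → 0# < x * y
  *-pos 0<x 0<y = *-nonneg (proj₁ 0<x) (proj₁ 0<y) ,
    λ 0≈xy → pos⇒≉0 0<y (x*y≈0⇒y≈0 (pos⇒≉0 0<x) (sym 0≈xy))

  +-pos : 0# < x → 0# ≤ y → 0# < x + y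
  +-pos 0<x 0≤y = <-≤-trans 0<x (≤-gap _ refl 0≤y)

  *-cancelˡ-≤ : 0# < z → z * x ≤ z * y → x ≤ y
  *-cancelˡ-≤ {z} {x} {y} 0<z zx≤zy with em {x ≤ y}
  ... | yes x≤y = x≤y
  ... | no  x≰y = contradiction zx≤zy
      (<⇒≱ (*-monoˡ-≤ (proj₁ 0<z) (proj₁ (≰⇒> x≰y)) , x≰y ∘ ≤-reflexive ∘ x≈y))
    where
    x≈y : z * y ≈ z * x → x ≈ y
    x≈y zy≈zx = begin
      x            ≈⟨ solve 2 (λ x y → x := y :+ (x :- y)) refl x y ⟩
      y + (x - y)  ≈⟨ +-congˡ (x*y≈0⇒y≈0 (pos⇒≉0 0<z) (begin
        z * (x - y)    ≈⟨ solve 3 (λ x y z → z :* (x :- y) := z :* x :- z :* y) refl x y z ⟩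
        z * x - z * y  ≈⟨ +-congˡ (-‿cong zy≈zx) ⟩
        z * x - z * x  ≈⟨ -‿inverseʳ _ ⟩
        0#             ∎)) ⟩
      y + 0#       ≈⟨ +-identityʳ y ⟩
      y            ∎
      where open import Relation.Binary.Reasoning.Setoid setoid

  ⁻¹-pos : 0# < x → 0# < x ⁻¹
  ⁻¹-pos {x} 0<x = ≰⇒> λ i≤0 → <⇒≱ 0<1 (begin
    1#        ≈⟨ ⁻¹-inverseʳ x (pos⇒≉0 0<x) ⟨
    x * x ⁻¹  ≤⟨ *-monoˡ-≤ (proj₁ 0<x) i≤0 ⟩
    x * 0#    ≈⟨ zeroʳ x ⟩
    0#        ∎)
    where open ≤-R

  *-⁻¹-cancel : ∀ x → 0# < z → z * (x * z ⁻¹) ≈ x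
  *-⁻¹-cancel {z} x 0<z = trans (solve 3 (λ x z i → z :* (x :* i) := x :* (z :* i)) refl x z (z ⁻¹))
    (trans (*-congˡ (⁻¹-inverseʳ z (pos⇒≉0 0<z))) (*-identityʳ x))

  ^-nonneg : 0# ≤ x → ∀ n → 0# ≤ x ^ n
  ^-nonneg 0≤x zero    = 0≤1
  ^-nonneg 0≤x (suc n) = *-nonneg 0≤x (^-nonneg 0≤x n)

  ^-pos : 0# < x → ∀ n → 0# < x ^ n
  ^-pos 0<x zero    = 0<1
  ^-pos 0<x (suc n) = *-pos 0<x (^-pos 0<x n)

  ^-mono-≤ : ∀ n → 0# ≤ x → x ≤ y → x ^ n ≤ y ^ n
  ^-mono-≤ zero    0≤x x≤y = ≤-refl
  ^-mono-≤ (suc n) 0≤x x≤y = *-mono-≤ 0≤x (^-nonneg 0≤x n) x≤y (^-mono-≤ n 0≤x x≤y)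

  -- Takes the place of extracting n-th roots. If `x ≤ y` fails, then
  -- `x * x ^ n ≤ y * y ^ n ≤ y * x ^ n`, and the positive factor `x ^ n` cancels.
  ^-cancel-≤ : ∀ n → 1 ℕ.≤ n → 0# ≤ y → x ^ n ≤ y ^ n → x ≤ y
  ^-cancel-≤ {y} {x} (suc n) _ 0≤y xⁿ≤yⁿ with em {x ≤ y}
  ... | yes x≤y = x≤y
  ... | no  x≰y = *-cancelˡ-≤ (^-pos 0<x n) (begin
    x ^ n * x    ≈⟨ *-comm _ _ ⟩
    x * x ^ n    ≤⟨ xⁿ≤yⁿ ⟩
    y * y ^ n    ≤⟨ *-monoˡ-≤ 0≤y (^-mono-≤ n 0≤y (proj₁ y<x)) ⟩
    y * x ^ n    ≈⟨ *-comm _ _ ⟩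
    x ^ n * y    ∎)
    where
    open ≤-R
    y<x = ≰⇒> x≰y
    0<x = ≤-<-trans 0≤y y<x

  1^n≈1 : ∀ n → 1# ^ n ≈ 1#
  1^n≈1 zero    = refl
  1^n≈1 (suc n) = trans (*-identityˡ _) (1^n≈1 n)

  1≤^ : 1# ≤ x → ∀ n → 1# ≤ x ^ n
  1≤^ 1≤x n = ≤-trans (≤-reflexive (sym (1^n≈1 n))) (^-mono-≤ n 0≤1 1≤x)

  ^≤1 : 0# ≤ x → x ≤ 1# → ∀ n → x ^ n ≤ 1#
  ^≤1 0≤x x≤1 n = ≤-trans (^-mono-≤ n 0≤x x≤1) (≤-reflexive (1^n≈1 n))

  ^-monoʳ-≤ : 1# ≤ x → m ℕ.≤ n → x ^ m ≤ x ^ n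
  ^-monoʳ-≤ {x} {m} {n} 1≤x m≤n = begin
    x ^ m                       ≈⟨ *-identityʳ _ ⟨
    x ^ m * 1#                  ≤⟨ *-monoˡ-≤ (^-nonneg (≤-trans 0≤1 1≤x) m) (1≤^ 1≤x (n ℕ.∸ m)) ⟩
    x ^ m * x ^ (n ℕ.∸ m)       ≈⟨ ^-homo-* x m (n ℕ.∸ m) ⟨
    x ^ (m ℕ.+ (n ℕ.∸ m))       ≡⟨ ≡.cong (x ^_) (ℕ.m+[n∸m]≡n m≤n) ⟩
    x ^ n                       ∎
    where open ≤-R

  *-^-distrib : ∀ x y n → (x * y) ^ n ≈ x ^ n * y ^ n
  *-^-distrib x y zero    = sym (*-identityˡ 1#)
  *-^-distrib x y (suc n) = trans (*-congˡ (*-^-distrib x y n))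
    (solve 4 (λ x y a b → x :* y :* (a :* b) := x :* a :* (y :* b)) refl x y (x ^ n) (y ^ n))

  0^n≈0 : 1 ℕ.≤ n → 0# ^ n ≈ 0#
  0^n≈0 {suc n} _ = zeroˡ _

  ^-cong-≈0 : 1 ℕ.≤ n → x ^ n ≤ 0# → 0# ≤ x → x ≈ 0#
  ^-cong-≈0 {n} 1≤n xⁿ≤0 0≤x = ≤-antisym
    (^-cancel-≤ n 1≤n ≤-refl (≤-trans xⁿ≤0 (≤-reflexive (sym (0^n≈0 1≤n))))) 0≤x

  fromℕ-nonneg : ∀ n → 0# ≤ fromℕ n
  fromℕ-nonneg zero    = ≤-refl
  fromℕ-nonneg (suc n) = +-nonneg 0≤1 (fromℕ-nonneg n)

  fromℕ-+ : ∀ m n → fromℕ (m ℕ.+ n) ≈ fromℕ m + fromℕ n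
  fromℕ-+ = ×-homo-+ 1#

  fromℕ-* : ∀ m n → fromℕ (m ℕ.* n) ≈ fromℕ m * fromℕ n
  fromℕ-* = ×1-homo-*

  fromℕ-mono-≤ : m ℕ.≤ n → fromℕ m ≤ fromℕ n
  fromℕ-mono-≤ {n = n} z≤n = fromℕ-nonneg n
  fromℕ-mono-≤ (s≤s m≤n)   = +-monoʳ-≤ 1# (fromℕ-mono-≤ m≤n)

  0<fromℕ-suc : ∀ n → 0# < fromℕ (suc n)
  0<fromℕ-suc n = +-pos 0<1 (fromℕ-nonneg n)

  fromℕ-pos : 1 ℕ.≤ n → 0# < fromℕ n
  fromℕ-pos {suc n} _ = 0<fromℕ-suc n

  1≤fromℕ : 1 ℕ.≤ n → 1# ≤ fromℕ n
  1≤fromℕ {suc n} _ = ≤-gap (fromℕ n) refl (fromℕ-nonneg n)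

  n<1+n : ∀ n → fromℕ n < fromℕ (suc n)
  n<1+n n = ≰⇒> λ 1+n≤n → <⇒≱ 0<1 (begin
    1#                       ≈⟨ solve 1 (λ x → :1 := :1 :+ x :- x) refl (fromℕ n) ⟩
    fromℕ (suc n) - fromℕ n  ≤⟨ +-monoˡ-≤ _ 1+n≤n ⟩
    fromℕ n - fromℕ n        ≈⟨ -‿inverseʳ _ ⟩
    0#                       ∎)
    where open ≤-R

  fromℕ-cancel-≤ : fromℕ m ≤ fromℕ n → m ℕ.≤ n
  fromℕ-cancel-≤ {m} {n} m≤n with m ℕ.≤? n
  ... | yes p = p
  ... | no ¬p = contradiction m≤n (<⇒≱ (<-≤-trans (n<1+n n) (fromℕ-mono-≤ (ℕ.≰⇒> ¬p))))

  fromℕ-cancel-< : fromℕ m < fromℕ n → m ℕ.< n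
  fromℕ-cancel-< m<n = ℕ.≰⇒> λ n≤m → <⇒≱ m<n (fromℕ-mono-≤ n≤m)

  -- A consequence of completeness: if the naturals had a supremum `s`, then `s - 1#` would bound
  -- them as well.
  archimedean : ∀ x → Σ[ n ∈ ℕ ] x ≤ fromℕ n
  archimedean x with em {Σ[ n ∈ ℕ ] x ≤ fromℕ n}
  ... | yes p = p
  ... | no ¬p = contradiction (proj₂ isSup (s - 1#) s-1-bound) (<⇒≱ (≰⇒> λ s≤s-1 → <⇒≱ 0<1 (begin
      1#               ≈⟨ solve 1 (λ s → :1 := s :- (s :- :1)) refl s ⟩
      s - (s - 1#)     ≤⟨ +-monoˡ-≤ _ s≤s-1 ⟩
      s - 1# - (s - 1#) ≈⟨ -‿inverseʳ _ ⟩
      0#               ∎)))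
    where
    open ≤-R
    Naturals : Pred ℝ 0ℓ
    Naturals z = Σ[ n ∈ ℕ ] z ≈ fromℕ n
    s = sup Naturals
    isSup : IsSupremum Naturals s
    isSup = sup-isSupremum Naturals (0# , 0 , refl)
      (x , λ { z (n , z≈n) → ≤-trans (≤-reflexive z≈n) (proj₁ (≰⇒> λ x≤n → ¬p (n , x≤n))) })
    s-1-bound : IsUpperBound Naturals (s - 1#)
    s-1-bound z (n , z≈n) = begin
      z                  ≈⟨ z≈n ⟩
      fromℕ n            ≈⟨ solve 1 (λ x → x := :1 :+ x :- :1) refl (fromℕ n) ⟩
      fromℕ (suc n) - 1# ≤⟨ +-monoˡ-≤ _ (proj₁ isSup _ (suc n , refl)) ⟩
      s - 1#             ∎

  floor : 0# ≤ x → Σ[ n ∈ ℕ ] fromℕ n ≤ x × x < fromℕ (suc n)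
  floor {x} 0≤x = search (suc N) (≤-<-trans (proj₂ (archimedean x)) (n<1+n N))
    where
    N = proj₁ (archimedean x)
    search : ∀ n → x < fromℕ n → Σ[ n ∈ ℕ ] fromℕ n ≤ x × x < fromℕ (suc n)
    search zero    x<0 = contradiction 0≤x (<⇒≱ x<0)
    search (suc n) x<1+n with em {fromℕ n ≤ x}
    ... | yes n≤x = n , n≤x , x<1+n
    ... | no  n≰x = search n (≰⇒> n≰x)

  n≤2^n : ∀ n → fromℕ n ≤ fromℕ 2 ^ n
  n≤2^n zero    = 0≤1
  n≤2^n (suc n) = begin
    1# + fromℕ n                 ≤⟨ +-mono-≤ (1≤^ 1≤2 n) (n≤2^n n) ⟩
    fromℕ 2 ^ n + fromℕ 2 ^ n    ≈⟨ solve 1 (λ x → x :+ x := :ℕ 2 :* x) refl (fromℕ 2 ^ n) ⟩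
    fromℕ 2 * fromℕ 2 ^ n        ∎
    where
    open ≤-R
    1≤2 : 1# ≤ fromℕ 2
    1≤2 = 1≤fromℕ {2} (s≤s z≤n)

  sum-mono-≤ : ∀ {n} {f g : Vector ℝ n} → (∀ i → f i ≤ g i) → sum f ≤ sum g
  sum-mono-≤ {zero}  f≤g = ≤-refl
  sum-mono-≤ {suc n} f≤g = +-mono-≤ (f≤g zero) (sum-mono-≤ (f≤g ∘ suc))

  sum-nonneg : ∀ {n} {f : Vector ℝ n} → (∀ i → 0# ≤ f i) → 0# ≤ sum f
  sum-nonneg {zero}  0≤f = ≤-refl
  sum-nonneg {suc n} 0≤f = +-nonneg (0≤f zero) (sum-nonneg (0≤f ∘ suc))

  term≤sum : ∀ {n} {f : Vector ℝ n} → (∀ i → 0# ≤ f i) → ∀ i → f i ≤ sum f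
  term≤sum 0≤f zero    = ≤-gap _ refl (sum-nonneg (0≤f ∘ suc))
  term≤sum 0≤f (suc i) = ≤-trans (term≤sum (0≤f ∘ suc) i) (≤-gap _ (+-comm _ _) (0≤f zero))

  sum-const : ∀ n {x} → sum {n} (λ _ → x) ≈ fromℕ n * x
  sum-const zero    = sym (zeroˡ _)
  sum-const (suc n) {x} = trans (+-congˡ (sum-const n))
    (solve 2 (λ n x → x :+ n :* x := (:1 :+ n) :* x) refl (fromℕ n) x)

-- Real powers as suprema, and AM-GM inequalities between integer powers.

module RealPowers (em : ExcludedMiddle 0ℓ) (R : RealNumbers) where

  open Testing R
  open RingSolver R
  open OrderedField em R
  open Solver

  private variable
    x y z w r : ℝ
    a b m n d : ℕ

  -- A Lipschitz bound to the right of `y`. In the inductive step the quadratic term `h * (h * K)`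
  -- is at most `h * K` because `h ≤ 1#`.
  ^-increment : 0# ≤ y → ∀ n →
    Σ[ K ∈ ℝ ] 0# ≤ K × (∀ h → 0# ≤ h → h ≤ 1# → (y + h) ^ n ≤ y ^ n + h * K)
  ^-increment 0≤y zero = 0# , ≤-refl , λ h _ _ →
    ≤-reflexive (solve 1 (λ h → :1 := :1 :+ h :* :0) refl h)
  ^-increment {y} 0≤y (suc n) with ^-increment 0≤y n
  ... | K , 0≤K , bound = y ^ n + (y * K + K) ,
    +-nonneg (^-nonneg 0≤y n) (+-nonneg (*-nonneg 0≤y 0≤K) 0≤K) , λ h 0≤h h≤1 → begin
      (y + h) * (y + h) ^ n                  ≤⟨ *-monoˡ-≤ (+-nonneg 0≤y 0≤h) (bound h 0≤h h≤1) ⟩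
      (y + h) * (y ^ n + h * K)              ≤⟨ ≤-gap (h * (K * (1# - h)))
        (solve 4 (λ y h Y K → y :* Y :+ h :* (Y :+ (y :* K :+ K))
           := (y :+ h) :* (Y :+ h :* K) :+ h :* (K :* (:1 :- h))) refl y h (y ^ n) K)
        (*-nonneg 0≤h (*-nonneg 0≤K (≤⇒0≤- h≤1))) ⟩
      y * y ^ n + h * (y ^ n + (y * K + K))  ∎
    where open ≤-R

  ^-continuity : 0# ≤ y → ∀ n → y ^ n < z → Σ[ x ∈ ℝ ] y < x × x ^ n ≤ z
  ^-continuity {y} {z} 0≤y n yⁿ<z with ^-increment 0≤y n
  ... | K , 0≤K , bound = y + h , y<y+h , (begin
      (y + h) ^ n      ≤⟨ bound h (proj₁ 0<h) h≤1 ⟩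
      y ^ n + h * K    ≤⟨ +-monoʳ-≤ _ hK≤δ ⟩
      y ^ n + δ        ≈⟨ solve 2 (λ Y z → Y :+ (z :- Y) := z) refl (y ^ n) z ⟩
      z                ∎)
    where
    open ≤-R
    δ = z - y ^ n
    0<δ : 0# < δ
    0<δ = ≰⇒> λ δ≤0 → <⇒≱ yⁿ<z (0≤-⇒≤ (≤-trans (≤0⇒0≤neg δ≤0)
            (≤-reflexive (solve 2 (λ Y z → :- (z :- Y) := Y :- z) refl (y ^ n) z))))
    -- With this denominator `h = δ / M` satisfies `h ≤ 1#` and `h * K ≤ δ` at once.
    M = δ + (1# + K)
    0≤1+K = +-nonneg 0≤1 0≤K
    0<M : 0# < M
    0<M = +-pos 0<δ 0≤1+K
    h = δ * M ⁻¹
    0<h : 0# < h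
    0<h = *-pos 0<δ (⁻¹-pos 0<M)
    Mh≈δ : M * h ≈ δ
    Mh≈δ = *-⁻¹-cancel δ 0<M
    h≤1 : h ≤ 1#
    h≤1 = *-cancelˡ-≤ 0<M (begin
      M * h      ≈⟨ Mh≈δ ⟩
      δ          ≤⟨ ≤-gap _ refl 0≤1+K ⟩
      M          ≈⟨ *-identityʳ M ⟨
      M * 1#     ∎)
    hK≤δ : h * K ≤ δ
    hK≤δ = begin
      h * K      ≤⟨ ≤-gap (δ * h + h)
        (solve 3 (λ δ h K → (δ :+ (:1 :+ K)) :* h := h :* K :+ (δ :* h :+ h)) refl δ h K)
        (+-nonneg (*-nonneg (proj₁ 0<δ) (proj₁ 0<h)) (proj₁ 0<h)) ⟩
      M * h      ≈⟨ Mh≈δ ⟩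
      δ          ∎
    y<y+h : y < y + h
    y<y+h = ≤-gap h refl (proj₁ 0<h) , λ y≈y+h → pos⇒≉0 0<h (trans
      (solve 2 (λ y h → h := y :+ h :- y) refl y h)
      (trans (+-congʳ (sym y≈y+h)) (-‿inverseʳ y)))

  -- The disjunction inside `BelowPower`: `a / b` lies on the side of `r` where `x^(a/b) ≤ x^r`, and
  -- that side switches at `x = 1`.
  ExponentBelow : ℝ → ℝ → ℕ → ℕ → Set
  ExponentBelow x r a b = (1# ≤ x × fromℕ a ≤ r * fromℕ b) ⊎ (x ≤ 1# × r * fromℕ b ≤ fromℕ a)

  module _ {x r} a b (0≤x : 0# ≤ x) (1≤b : 1 ℕ.≤ b) (below : ExponentBelow x r a b) where

    private
      N = proj₁ (archimedean r)

      -- One bound serves both sides of 1: the base `1# + x` dominates `x`, and, being at least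
      -- `1#`, its powers dominate `x ^ a` when `x ≤ 1#`. The integer `N ≥ r` absorbs the exponent.
      bounded : IsUpperBound (BelowPower x r) ((1# + x) ^ N)
      bounded z (0≤z , a , b , 1≤b , below , zᵇ≤xᵃ) =
        ^-cancel-≤ b 1≤b (^-nonneg 0≤1+x N) (≤-trans zᵇ≤xᵃ (bound below))
        where
        open ≤-R
        0≤1+x = +-nonneg 0≤1 0≤x
        1≤1+x : 1# ≤ 1# + x
        1≤1+x = ≤-gap x refl 0≤x
        bound : ExponentBelow x r a b → x ^ a ≤ ((1# + x) ^ N) ^ b
        bound (inj₁ (1≤x , a≤rb)) = begin
          x ^ a                    ≤⟨ ^-mono-≤ a 0≤x (≤-gap 1# (+-comm _ _) 0≤1) ⟩
          (1# + x) ^ a             ≤⟨ ^-monoʳ-≤ 1≤1+x (fromℕ-cancel-≤ {a} {N ℕ.* b} (begin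
            fromℕ a            ≤⟨ a≤rb ⟩
            r * fromℕ b        ≤⟨ *-monoʳ-≤ (fromℕ-nonneg b) (proj₂ (archimedean r)) ⟩
            fromℕ N * fromℕ b  ≈⟨ fromℕ-* N b ⟨
            fromℕ (N ℕ.* b)    ∎)) ⟩
          (1# + x) ^ (N ℕ.* b)     ≈⟨ ^-assocʳ (1# + x) N b ⟨
          ((1# + x) ^ N) ^ b       ∎
        bound (inj₂ (x≤1 , _)) = ≤-trans (^≤1 0≤x x≤1 a) (1≤^ (1≤^ 1≤1+x N) b)

      -- `sup` is unspecified on an empty predicate, so one admissible pair `a`, `b` has to be
      -- supplied to show that the predicate is inhabited.
      zero-below : BelowPower x r 0#
      zero-below = ≤-refl , a , b , 1≤b , below ,
        ≤-trans (≤-reflexive (0^n≈0 1≤b)) (^-nonneg 0≤x a)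

      isSup : IsSupremum (BelowPower x r) (x ^ʳ r)
      isSup = sup-isSupremum (BelowPower x r) (0# , zero-below) ((1# + x) ^ N , bounded)

    ^ʳ-nonneg : 0# ≤ x ^ʳ r
    ^ʳ-nonneg = proj₁ isSup 0# zero-below

    -- No b-th root of `x ^ a` is at hand to put into the predicate. But if `(x ^ʳ r) ^ b` were
    -- smaller, continuity would give some `z` above `x ^ʳ r` with `z ^ b` still at most `x ^ a`.
    -- This `z` belongs to `BelowPower` and exceeds its supremum.
    ^≤^ʳ^ : x ^ a ≤ (x ^ʳ r) ^ b
    ^≤^ʳ^ = ≮⇒≥ λ yᵇ<xᵃ → refute (^-continuity ^ʳ-nonneg b yᵇ<xᵃ)
      where
      refute : ¬ (Σ[ z ∈ ℝ ] x ^ʳ r < z × z ^ b ≤ x ^ a)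
      refute (z , y<z , zᵇ≤xᵃ) = <⇒≱ y<z
        (proj₁ isSup z (≤-trans ^ʳ-nonneg (proj₁ y<z) , a , b , 1≤b , below , zᵇ≤xᵃ))

  0≤^ʳ : 0# ≤ x → 0# ≤ r → 0# ≤ x ^ʳ r
  0≤^ʳ {x} {r} 0≤x 0≤r with total 1# x
  ... | inj₁ 1≤x = ^ʳ-nonneg 0 1 0≤x ℕ.≤-refl
    (inj₁ (1≤x , *-nonneg 0≤r (fromℕ-nonneg 1)))
  ... | inj₂ x≤1 = ^ʳ-nonneg (proj₁ (archimedean r)) 1 0≤x ℕ.≤-refl
    (inj₂ (x≤1 , ≤-trans (≤-reflexive (solve 1 (λ r → r :* :ℕ 1 := r) refl r)) (proj₂ (archimedean r))))

  -- AM-GM for one copy of `x` and `n` copies of `y`, homogeneous and free of division. The gap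
  -- obeys a recursion: the new one is `x` times the old one plus `(n + 1) * y ^ n * (x - y)²`.
  bernoulli : 0# ≤ x → 0# ≤ y → ∀ n →
    fromℕ (suc n) * (x * y ^ n) ≤ x ^ suc n + fromℕ n * y ^ suc n
  bernoulli {x} {y} 0≤x 0≤y zero = ≤-reflexive
    (solve 2 (λ x y → :ℕ 1 :* (x :* :1) := x :* :1 :+ :0 :* (y :* :1)) refl x y)
  bernoulli {x} {y} 0≤x 0≤y (suc n) = ≤-gap
    (x * g + N+1 * (Y * ((x - y) * (x - y))))
    (solve 5 (λ x y N X Y →
        x :* (x :* X) :+ (:1 :+ N) :* (y :* (y :* Y))
      := (:1 :+ (:1 :+ N)) :* (x :* (y :* Y))
         :+ (x :* (x :* X :+ N :* (y :* Y) :- (:1 :+ N) :* (x :* Y))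
             :+ (:1 :+ N) :* (Y :* ((x :- y) :* (x :- y))))) refl x y (fromℕ n) (x ^ n) Y)
    (+-nonneg (*-nonneg 0≤x (≤⇒0≤- (bernoulli 0≤x 0≤y n)))
      (*-nonneg (fromℕ-nonneg (suc n)) (*-nonneg (^-nonneg 0≤y n) (square-nonneg (x - y)))))
    where
    N+1 = fromℕ (suc n)
    Y = y ^ n
    g = x ^ suc n + fromℕ n * y ^ suc n - N+1 * (x * Y)

  -- Here `x` is the mean of `n` copies of `y` and one `1#`. This equation collapses all terms of
  -- the gap in `bernoulli` other than `x ^ suc n` to `- y ^ n`.
  ^≤^suc : 0# ≤ x → 0# ≤ y → ∀ n → fromℕ (suc n) * x ≈ fromℕ n * y + 1# → y ^ n ≤ x ^ suc n
  ^≤^suc {x} {y} 0≤x 0≤y n eq = 0≤-⇒≤ (≤-trans (≤⇒0≤- (bernoulli 0≤x 0≤y n)) (≤-reflexive (begin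
    X + N * (y * Y) - N+1 * (x * Y)          ≈⟨ solve 6 (λ x y N N+1 X Y → X :+ N :*
        (y :* Y) :- N+1 :* (x :* Y)
                                                   := X :+ (N :* y :- N+1 :* x) :* Y) refl x y N N+1 X Y ⟩
    X + (N * y - N+1 * x) * Y                ≈⟨ +-congˡ (*-congʳ (+-congˡ (-‿cong eq))) ⟩
    X + (N * y - (N * y + 1#)) * Y           ≈⟨ solve 4 (λ y N X Y → X :+ (N :* y :- (N :* y :+ :1)) :* Y
                                                   := X :- Y) refl y N X Y ⟩
    X - Y                                    ∎)))
    where
    open import Relation.Binary.Reasoning.Setoid setoid
    N = fromℕ n
    N+1 = fromℕ (suc n)
    X = x ^ suc n
    Y = y ^ n

  -- The AM–GM inequality for b copies of t and n copies of 1.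
  weighted-AM-GM : 1 ℕ.≤ b → ∀ n {t v} → 0# ≤ t → 0# ≤ v →
    fromℕ (n ℕ.+ b) * v ≈ fromℕ b * t + fromℕ n → t ^ b ≤ v ^ (n ℕ.+ b)
  weighted-AM-GM {b} 1≤b zero {t} {v} 0≤t 0≤v eq = ^-mono-≤ b 0≤t
    (*-cancelˡ-≤ (fromℕ-pos 1≤b) (≤-reflexive (sym (trans eq (+-identityʳ _)))))
  weighted-AM-GM {b} 1≤b (suc n) {t} {v} 0≤t 0≤v eq =
    ≤-trans (weighted-AM-GM 1≤b n 0≤t 0≤u Nu≈) (^≤^suc 0≤v 0≤u (n ℕ.+ b) (begin
      fromℕ (suc n ℕ.+ b) * v         ≈⟨ eq ⟩
      fromℕ b * t + (1# + fromℕ n)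
        ≈⟨ solve 2 (λ x n → x :+ (:1 :+ n) := x :+ n :+ :1) refl (fromℕ b * t) (fromℕ n) ⟩
      fromℕ b * t + fromℕ n + 1#      ≈⟨ +-congʳ Nu≈ ⟨
      fromℕ (n ℕ.+ b) * u + 1#        ∎))
    where
    open import Relation.Binary.Reasoning.Setoid setoid
    N = fromℕ (n ℕ.+ b)
    0<N : 0# < N
    0<N = fromℕ-pos (ℕ.≤-trans 1≤b (ℕ.m≤n+m b n))
    u = (fromℕ b * t + fromℕ n) * N ⁻¹
    0≤u : 0# ≤ u
    0≤u = *-nonneg (+-nonneg (*-nonneg (fromℕ-nonneg b) 0≤t) (fromℕ-nonneg n)) (proj₁ (⁻¹-pos 0<N))
    Nu≈ : N * u ≈ fromℕ b * t + fromℕ n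
    Nu≈ = *-⁻¹-cancel _ 0<N

  -- With `a = n + b`, the function `t^(b/a)` is concave, and the right side is `a` times its
  -- tangent line at `t = 1`. Being linear in `t`, it can be summed over coordinates in
  -- `power-mean`.
  tangent-bound : 1 ℕ.≤ b → ∀ n {x t} → 0# ≤ t → x ^ (n ℕ.+ b) ≤ t ^ b →
    fromℕ (n ℕ.+ b) * x ≤ fromℕ b * t + fromℕ n
  tangent-bound {b} 1≤b n {x} {t} 0≤t xᵃ≤tᵇ = begin
    N * x                    ≤⟨ *-monoˡ-≤ (proj₁ 0<N) (^-cancel-≤ (n ℕ.+ b) 1≤n+b 0≤u
                                  (≤-trans xᵃ≤tᵇ (weighted-AM-GM 1≤b n 0≤t 0≤u Nu≈))) ⟩
    N * u                    ≈⟨ Nu≈ ⟩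
    fromℕ b * t + fromℕ n    ∎
    where
    open ≤-R
    N = fromℕ (n ℕ.+ b)
    1≤n+b = ℕ.≤-trans 1≤b (ℕ.m≤n+m b n)
    0<N : 0# < N
    0<N = fromℕ-pos 1≤n+b
    u = (fromℕ b * t + fromℕ n) * N ⁻¹
    0≤u : 0# ≤ u
    0≤u = *-nonneg (+-nonneg (*-nonneg (fromℕ-nonneg b) 0≤t) (fromℕ-nonneg n)) (proj₁ (⁻¹-pos 0<N))
    Nu≈ : N * u ≈ fromℕ b * t + fromℕ n
    Nu≈ = *-⁻¹-cancel _ 0<N

-- Comparison of the ℓ₁ norm with the ℓₚ norm.

module NormBounds (em : ExcludedMiddle 0ℓ) (R : RealNumbers) where

  open Testing R
  open RingSolver R
  open OrderedField em R
  open RealPowers em R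
  open import Algebra.Construct.NaturalChoice.Max totalOrder using (x≤y⇒y⊔x≈y; x≤x⊔y; x≤y⊔x)
  open import Algebra.Properties.Semiring.Sum semiring using (*-distribˡ-sum; *-distribʳ-sum)
  open import Algebra.Properties.CommutativeMonoid.Sum +-commutativeMonoid using (sum-cong-≋; ∑-distrib-+)
  open Solver

  -- Hölder's inequality with a factor `2 ^ a` lost, where `a = n + b`. Exact normalisation would
  -- take an a-th root. Suppose instead that the bound fails, and divide `x` by `y = X / (2 δ)` and
  -- `t` by `Θ = T / δ`. The failure yields `Θ ^ b ≤ y ^ a`, so the hypothesis survives the
  -- rescaling. The new vectors have means 2 and 1, and the summed tangent bounds give
  -- `2 a δ ≤ a δ`.
  power-mean : ∀ {b d} → 1 ℕ.≤ b → ∀ n (x t : Vector ℝ d) →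
    (∀ i → 0# ≤ x i) → (∀ i → 0# ≤ t i) → (∀ i → x i ^ (n ℕ.+ b) ≤ t i ^ b) →
    sum x ^ (n ℕ.+ b) ≤ fromℕ 2 ^ (n ℕ.+ b) * (sum t ^ b * fromℕ d ^ n)
  power-mean {b} {zero} 1≤b n x t 0≤x 0≤t xᵃ≤tᵇ = ≤-trans
    (≤-reflexive (0^n≈0 (ℕ.≤-trans 1≤b (ℕ.m≤n+m b n))))
    (*-nonneg (^-nonneg (fromℕ-nonneg 2) (n ℕ.+ b)) (*-nonneg (^-nonneg ≤-refl b) (^-nonneg ≤-refl n)))
  power-mean {b} {suc d-1} 1≤b n x t 0≤x 0≤t xᵃ≤tᵇ = ≮⇒≥ λ rhs<Xᵃ →
                                                       refute rhs<Xᵃ (0≤⇒0<⊎≈0 (sum-nonneg 0≤t))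
    where
    d⁺ = suc d-1
    a = n ℕ.+ b
    1≤a = ℕ.≤-trans 1≤b (ℕ.m≤n+m b n)
    X = sum x
    T = sum t
    δ = fromℕ d⁺
    0<δ = 0<fromℕ-suc d-1
    rhs = fromℕ 2 ^ a * (T ^ b * δ ^ n)
    0≤rhs : 0# ≤ rhs
    0≤rhs = *-nonneg (^-nonneg (fromℕ-nonneg 2) a)
      (*-nonneg (^-nonneg (sum-nonneg 0≤t) b) (^-nonneg (proj₁ 0<δ) n))
    0≤X = sum-nonneg 0≤x

    module Positive (rhs<Xᵃ : rhs < X ^ a) (0<T : 0# < T) where
      0<X : 0# < X
      0<X = ≰⇒> λ X≤0 → <⇒≱ rhs<Xᵃ (≤-trans (^-mono-≤ a 0≤X X≤0)
              (≤-trans (≤-reflexive (0^n≈0 1≤a)) 0≤rhs))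
      0<2δ = *-pos (0<fromℕ-suc 1) 0<δ
      y = X * (fromℕ 2 * δ) ⁻¹
      Θ = T * δ ⁻¹
      0<y = *-pos 0<X (⁻¹-pos 0<2δ)
      0<Θ = *-pos 0<T (⁻¹-pos 0<δ)
      X≈2δy : fromℕ 2 * δ * y ≈ X
      X≈2δy = *-⁻¹-cancel X 0<2δ
      T≈δΘ : δ * Θ ≈ T
      T≈δΘ = *-⁻¹-cancel T 0<δ
      2δᵃ = (fromℕ 2 * δ) ^ a

      open ≤-R

      Θᵇ≤yᵃ : Θ ^ b ≤ y ^ a
      Θᵇ≤yᵃ = *-cancelˡ-≤ (^-pos 0<2δ a) (begin
        2δᵃ * Θ ^ b                                ≈⟨ *-congʳ (*-^-distrib (fromℕ 2) δ a) ⟩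
        fromℕ 2 ^ a * δ ^ a * Θ ^ b                ≈⟨ *-congʳ (*-congˡ (^-homo-* δ n b)) ⟩
        fromℕ 2 ^ a * (δ ^ n * δ ^ b) * Θ ^ b      ≈⟨ solve 4 (λ p q r s → p :* (q :* r) :* s
            := p :* (r :* s :* q))
                                                        refl (fromℕ 2 ^ a) (δ ^ n) (δ ^ b) (Θ ^ b) ⟩
        fromℕ 2 ^ a * (δ ^ b * Θ ^ b * δ ^ n)
          ≈⟨ *-congˡ (*-congʳ (trans (sym (*-^-distrib δ Θ b)) (^-congˡ b T≈δΘ))) ⟩
        rhs                                        ≤⟨ proj₁ rhs<Xᵃ ⟩
        X ^ a                                      ≈⟨ ^-congˡ a X≈2δy ⟨
        (fromℕ 2 * δ * y) ^ a                      ≈⟨ *-^-distrib (fromℕ 2 * δ) y a ⟩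
        2δᵃ * y ^ a                                ∎)

      x′ t′ : Vector ℝ d⁺
      x′ i = x i * y ⁻¹
      t′ i = t i * Θ ⁻¹
      0≤t′ : ∀ i → 0# ≤ t′ i
      0≤t′ i = *-nonneg (0≤t i) (proj₁ (⁻¹-pos 0<Θ))

      x′ᵃ≤t′ᵇ : ∀ i → x′ i ^ a ≤ t′ i ^ b
      x′ᵃ≤t′ᵇ i = *-cancelˡ-≤ (^-pos 0<y a) (begin
        y ^ a * x′ i ^ a    ≈⟨ *-^-distrib y (x′ i) a ⟨
        (y * x′ i) ^ a      ≈⟨ ^-congˡ a (*-⁻¹-cancel (x i) 0<y) ⟩
        x i ^ a             ≤⟨ xᵃ≤tᵇ i ⟩
        t i ^ b             ≈⟨ ^-congˡ b (*-⁻¹-cancel (t i) 0<Θ) ⟨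
        (Θ * t′ i) ^ b      ≈⟨ *-^-distrib Θ (t′ i) b ⟩
        Θ ^ b * t′ i ^ b    ≤⟨ *-monoʳ-≤ (^-nonneg (0≤t′ i) b) Θᵇ≤yᵃ ⟩
        y ^ a * t′ i ^ b    ∎)

      rescaled-sum : ∀ {z w} (f : Vector ℝ d⁺) → 0# < z → w * z ≈ sum f → sum (λ i → f i * z ⁻¹) ≈ w
      rescaled-sum {z} {w} f 0<z wz≈f = trans (sym (*-distribʳ-sum (z ⁻¹) f))
        (trans (*-congʳ (sym wz≈f)) (trans (*-assoc w z (z ⁻¹))
          (trans (*-congˡ (⁻¹-inverseʳ z (pos⇒≉0 0<z))) (*-identityʳ w))))

      a*2δ≤a*δ : fromℕ a * (fromℕ 2 * δ) ≤ fromℕ a * δ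
      a*2δ≤a*δ = begin
        fromℕ a * (fromℕ 2 * δ)                       ≈⟨ *-congˡ (rescaled-sum x 0<y X≈2δy) ⟨
        fromℕ a * sum x′                              ≈⟨ *-distribˡ-sum (fromℕ a) x′ ⟩
        sum (λ i → fromℕ a * x′ i)
          ≤⟨ sum-mono-≤ (λ i → tangent-bound 1≤b n (0≤t′ i) (x′ᵃ≤t′ᵇ i)) ⟩
        sum (λ i → fromℕ b * t′ i + fromℕ n)
          ≈⟨ ∑-distrib-+ (λ i → fromℕ b * t′ i) (λ _ → fromℕ n) ⟩
        sum (λ i → fromℕ b * t′ i) + sum {d⁺} (λ _ → fromℕ n)
          ≈⟨ +-cong (sym (*-distribˡ-sum (fromℕ b) t′)) (sum-const d⁺) ⟩
        fromℕ b * sum t′ + δ * fromℕ n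
          ≈⟨ +-congʳ (*-congˡ (rescaled-sum t 0<Θ T≈δΘ)) ⟩
        fromℕ b * δ + δ * fromℕ n
          ≈⟨ solve 3 (λ b n δ → b :* δ :+ δ :* n := (n :+ b) :* δ) refl (fromℕ b) (fromℕ n) δ ⟩
        (fromℕ n + fromℕ b) * δ                       ≈⟨ *-congʳ (fromℕ-+ n b) ⟨
        fromℕ a * δ                                   ∎

      contra : δ ≤ 0#
      contra = begin
        δ                 ≈⟨ solve 1 (λ δ → δ := :ℕ 2 :* δ :- δ) refl δ ⟩
        fromℕ 2 * δ - δ   ≤⟨ +-monoˡ-≤ (- δ) (*-cancelˡ-≤ (fromℕ-pos 1≤a) a*2δ≤a*δ) ⟩
        δ - δ             ≈⟨ -‿inverseʳ δ ⟩
        0#                ∎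

    refute : rhs < X ^ a → ¬ (0# < T ⊎ T ≈ 0#)
    refute rhs<Xᵃ (inj₁ 0<T) = <⇒≱ 0<δ (Positive.contra rhs<Xᵃ 0<T)
    -- Rescaling by `Θ` is impossible here, but every `t i` and hence every `x i` vanishes.
    refute rhs<Xᵃ (inj₂ T≈0) = <⇒≱ rhs<Xᵃ (begin
      X ^ a    ≈⟨ ^-congˡ a (trans (sum-cong-≋ x≈0) (trans (sum-const d⁺) (zeroʳ δ))) ⟩
      0# ^ a   ≈⟨ 0^n≈0 1≤a ⟩
      0#       ≤⟨ 0≤rhs ⟩
      rhs      ∎)
      where
      open ≤-R
      x≈0 : ∀ i → x i ≈ 0#
      x≈0 i = ^-cong-≈0 1≤a (begin
        x i ^ a  ≤⟨ xᵃ≤tᵇ i ⟩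
        t i ^ b  ≤⟨ ^-mono-≤ b (0≤t i) (≤-trans (term≤sum 0≤t i) (≤-reflexive T≈0)) ⟩
        0# ^ b   ≈⟨ 0^n≈0 1≤b ⟩
        0#       ∎) (0≤x i)

  truncate : ℝ → ℝ → ℝ
  truncate η x = if does (em {η ≤ x}) then x else 0#

  truncate-spec : ∀ η x → (η ≤ x × truncate η x ≡ x) ⊎ (x ≤ η × truncate η x ≡ 0#)
  truncate-spec η x with em {η ≤ x}
  ... | yes η≤x = inj₁ (η≤x , ≡.refl)
  ... | no  η≰x = inj₂ (proj₁ (≰⇒> η≰x) , ≡.refl)

  truncate-nonneg : ∀ η {x} → 0# ≤ x → 0# ≤ truncate η x
  truncate-nonneg η {x} 0≤x with em {η ≤ x}
  ... | yes _ = 0≤x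
  ... | no  _ = ≤-refl

  ≤truncate+ : ∀ {η} x → 0# ≤ η → x ≤ truncate η x + η
  ≤truncate+ {η} x 0≤η with em {η ≤ x}
  ... | yes _   = ≤-gap η refl 0≤η
  ... | no  η≰x = ≤-trans (proj₁ (≰⇒> η≰x)) (≤-reflexive (sym (+-identityˡ η)))

  -- Truncation from below makes the loss from rounding p to a/b at most a factor 2.
  truncate^≤ : ∀ {p η} {x} {a b} → 1 ℕ.≤ a → 1 ℕ.≤ b → 0# ≤ x → 1# ≤ fromℕ 2 ^ b * η →
    fromℕ a ≤ p * fromℕ b → p * fromℕ b ≤ fromℕ (suc a) →
    truncate η x ^ a ≤ (fromℕ 2 * x ^ʳ p) ^ b
  truncate^≤ {p} {η} {x} {a} {b} 1≤a 1≤b 0≤x 1≤2ᵇη a≤pb pb≤1+a =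
    ≤-trans (by-size (truncate-spec η x) (total 1# x))
      (≤-reflexive (sym (*-^-distrib (fromℕ 2) (x ^ʳ p) b)))
    where
    open ≤-R
    2ᵇ = fromℕ 2 ^ b
    0≤2ᵇ : 0# ≤ 2ᵇ
    0≤2ᵇ = ^-nonneg (fromℕ-nonneg 2) b
    rhs = 2ᵇ * (x ^ʳ p) ^ b
    by-size : (η ≤ x × truncate η x ≡ x) ⊎ (x ≤ η × truncate η x ≡ 0#) → 1# ≤ x ⊎ x ≤ 1# →
      truncate η x ^ a ≤ rhs
    by-size (inj₁ (η≤x , eq)) (inj₁ 1≤x) = begin
      truncate η x ^ a       ≡⟨ ≡.cong (_^ a) eq ⟩
      x ^ a                  ≈⟨ *-identityˡ _ ⟨
      1# * x ^ a             ≤⟨ *-monoʳ-≤ (^-nonneg 0≤x a) (1≤^ (1≤fromℕ {2} (s≤s z≤n)) b) ⟩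
      2ᵇ * x ^ a             ≤⟨ *-monoˡ-≤ 0≤2ᵇ (^≤^ʳ^ a b 0≤x 1≤b (inj₁ (1≤x , a≤pb))) ⟩
      rhs                    ∎
    by-size (inj₁ (η≤x , eq)) (inj₂ x≤1) = begin
      truncate η x ^ a       ≡⟨ ≡.cong (_^ a) eq ⟩
      x ^ a                  ≈⟨ *-identityˡ _ ⟨
      1# * x ^ a             ≤⟨ *-monoʳ-≤ (^-nonneg 0≤x a) (≤-trans 1≤2ᵇη (*-monoˡ-≤ 0≤2ᵇ η≤x)) ⟩
      2ᵇ * x * x ^ a         ≈⟨ *-assoc 2ᵇ x (x ^ a) ⟩
      2ᵇ * x ^ suc a         ≤⟨ *-monoˡ-≤ 0≤2ᵇ (^≤^ʳ^ (suc a) b 0≤x 1≤b (inj₂ (x≤1 , pb≤1+a))) ⟩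
      rhs                    ∎
    by-size (inj₂ (_ , eq)) x⊎1 = begin
      truncate η x ^ a       ≡⟨ ≡.cong (_^ a) eq ⟩
      0# ^ a                 ≈⟨ 0^n≈0 1≤a ⟩
      0#                     ≤⟨ *-nonneg 0≤2ᵇ (^-nonneg (0≤x^p x⊎1) b) ⟩
      rhs                    ∎
      where
      0≤x^p : 1# ≤ x ⊎ x ≤ 1# → 0# ≤ x ^ʳ p
      0≤x^p (inj₁ 1≤x) = ^ʳ-nonneg a b 0≤x 1≤b (inj₁ (1≤x , a≤pb))
      0≤x^p (inj₂ x≤1) = ^ʳ-nonneg (suc a) b 0≤x 1≤b (inj₂ (x≤1 , pb≤1+a))

  -- The comparison for a finite exponent.

  module _ {p : ℝ} (1≤p : 1# ≤ p) where

    private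
      0<p : 0# < p
      0<p = <-≤-trans 0<1 1≤p

      p⁻¹≤1 : p ⁻¹ ≤ 1#
      p⁻¹≤1 = *-cancelˡ-≤ 0<p (≤-trans (≤-reflexive (⁻¹-inverseʳ p (pos⇒≉0 0<p)))
                (≤-trans 1≤p (≤-reflexive (sym (*-identityʳ p)))))

    ⁻¹-transposeˡ : ∀ {x y} → x ≤ p * y → p ⁻¹ * x ≤ y
    ⁻¹-transposeˡ {x} {y} x≤py = *-cancelˡ-≤ 0<p
      (≤-trans (≤-reflexive (trans (*-congˡ (*-comm _ _)) (*-⁻¹-cancel x 0<p))) x≤py)

    ⁻¹-transposeʳ : ∀ {x y} → p * x ≤ y → x ≤ p ⁻¹ * y
    ⁻¹-transposeʳ {x} {y} px≤y = *-cancelˡ-≤ 0<p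
      (≤-trans px≤y (≤-reflexive (sym (trans (*-congˡ (*-comm _ _)) (*-⁻¹-cancel y 0<p)))))

    module PowerSum {d : ℕ} (1≤d : 1 ℕ.≤ d) (x : Vector ℝ d) (0≤x : ∀ i → 0# ≤ x i) where

      τ s D S : ℝ
      τ = sum (λ i → x i ^ʳ p)
      s = τ ^ʳ (p ⁻¹)
      D = fromℕ d ^ʳ (fromℕ 2 - fromℕ 2 * p ⁻¹)
      S = sum x

      0≤t : ∀ i → 0# ≤ x i ^ʳ p
      0≤t i = 0≤^ʳ (0≤x i) (proj₁ 0<p)

      0≤τ : 0# ≤ τ
      0≤τ = sum-nonneg 0≤t

      0≤s : 0# ≤ s
      0≤s = 0≤^ʳ 0≤τ (proj₁ (⁻¹-pos 0<p))

      d^≤D^ : ∀ m n → 1 ℕ.≤ n → fromℕ m ≤ (fromℕ 2 - fromℕ 2 * p ⁻¹) * fromℕ n →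
        fromℕ d ^ m ≤ D ^ n
      d^≤D^ m n 1≤n m≤rn = ^≤^ʳ^ m n (fromℕ-nonneg d) 1≤n (inj₁ (1≤fromℕ 1≤d , m≤rn))

      1≤D : 1# ≤ D
      1≤D = ≤-trans (d^≤D^ 0 1 ℕ.≤-refl
          (*-nonneg (≤-trans (*-nonneg (fromℕ-nonneg 2) (≤⇒0≤- p⁻¹≤1))
            (≤-reflexive (solve 1 (λ q → :ℕ 2 :* (:1 :- q) := :ℕ 2 :- :ℕ 2 :* q)
                refl (p ⁻¹)))) (fromℕ-nonneg 1)))
        (≤-reflexive (*-identityʳ D))

      0≤D : 0# ≤ D
      0≤D = ≤-trans 0≤1 1≤D

      -- Squared because the exponent of `D` is twice the usual `1 - 1/p`. The 16 is a factor 2 for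
      -- truncation times a factor 8 for rounding the exponent.
      rhs = fromℕ 16 * s * (fromℕ 16 * s) * D

      module Positive (0<S : 0# < S) where
        open ≤-R
        0<2δ : 0# < fromℕ 2 * fromℕ d
        0<2δ = *-pos (0<fromℕ-suc 1) (fromℕ-pos 1≤d)
        -- At most `d` entries are dropped, each at most `η`, so truncation loses at most
        -- `d * η = S / 2`.
        η = S * (fromℕ 2 * fromℕ d) ⁻¹
        0<η : 0# < η
        0<η = *-pos 0<S (⁻¹-pos 0<2δ)

        y : Vector ℝ d
        y i = truncate η (x i)
        0≤y : ∀ i → 0# ≤ y i
        0≤y i = truncate-nonneg η (0≤x i)
        S′ = sum y
        0≤S′ : 0# ≤ S′
        0≤S′ = sum-nonneg 0≤y

        S≤2S′ : S ≤ fromℕ 2 * S′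
        S≤2S′ = 0≤-⇒≤ (begin
          0#                                              ≤⟨ ≤⇒0≤- S≤ ⟩
          S′ + fromℕ d * η - S                            ≈⟨ +-congˡ (-‿cong (*-⁻¹-cancel S 0<2δ)) ⟨
          S′ + fromℕ d * η - fromℕ 2 * fromℕ d * η        ≈⟨ solve 3 (λ S δ η
              → S :+ δ :* η :- :ℕ 2 :* δ :* η
                                                               := :ℕ 2 :* S :- (S :+ δ :* η))
                                                                   refl S′ (fromℕ d) η ⟩
          fromℕ 2 * S′ - (S′ + fromℕ d * η)               ≤⟨ +-monoʳ-≤ _ (neg-mono-≤ S≤) ⟩
          fromℕ 2 * S′ - S                                ∎)
          where
          S≤ : S ≤ S′ + fromℕ d * η
          S≤ = begin
            sum x                        ≤⟨ sum-mono-≤ (λ i → ≤truncate+ (x i) (proj₁ 0<η)) ⟩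
            sum (λ i → y i + η)          ≈⟨ ∑-distrib-+ y (λ _ → η) ⟩
            S′ + sum {d} (λ _ → η)       ≈⟨ +-congˡ (sum-const d) ⟩
            S′ + fromℕ d * η             ∎

        S′≤S : S′ ≤ S
        S′≤S = sum-mono-≤ (λ i → y≤x (truncate-spec η (x i)))
          where
          y≤x : ∀ {i} → (η ≤ x i × y i ≡ x i) ⊎ (x i ≤ η × y i ≡ 0#) → y i ≤ x i
          y≤x (inj₁ (_ , eq)) = ≤-reflexive (reflexive eq)
          y≤x {i} (inj₂ (_ , eq)) = ≤-trans (≤-reflexive (reflexive eq)) (0≤x i)

        -- Chosen so that `2 ^ b` exceeds both `η ⁻¹` and `S`. A base `x` with `η ≤ x ≤ 1` forces
        -- the numerator `a + 1`, which costs a factor `1 / x ≤ η ⁻¹`; a power sum `τ ≥ 1` leaves a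
        -- spare factor `s`, relevant only when it is at most `S`. After a-th roots each of these
        -- losses is at most 2.
        b : ℕ
        b = suc (proj₁ (archimedean (η ⁻¹ + S)))
        1≤b : 1 ℕ.≤ b
        1≤b = s≤s z≤n
        2ᵇ = fromℕ 2 ^ b
        η⁻¹+S≤2ᵇ : η ⁻¹ + S ≤ 2ᵇ
        η⁻¹+S≤2ᵇ = ≤-trans (proj₂ (archimedean (η ⁻¹ + S)))
          (≤-trans (proj₁ (n<1+n (proj₁ (archimedean (η ⁻¹ + S))))) (n≤2^n b))
        1≤2ᵇη : 1# ≤ 2ᵇ * η
        1≤2ᵇη = begin
          1#            ≈⟨ ⁻¹-inverseʳ η (pos⇒≉0 0<η) ⟨
          η * η ⁻¹      ≈⟨ *-comm _ _ ⟩
          η ⁻¹ * η      ≤⟨ *-monoʳ-≤ (proj₁ 0<η) (≤-trans (≤-gap S refl (proj₁ 0<S)) η⁻¹+S≤2ᵇ) ⟩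
          2ᵇ * η        ∎
        S′≤2ᵇ : S′ ≤ 2ᵇ
        S′≤2ᵇ = ≤-trans S′≤S (≤-trans (≤-gap (η ⁻¹) (+-comm _ _) (proj₁ (⁻¹-pos 0<η))) η⁻¹+S≤2ᵇ)

        module Rounded {n}
          (a≤pb : fromℕ (n ℕ.+ b) ≤ p * fromℕ b)
          (pb≤1+a : p * fromℕ b ≤ fromℕ (suc (n ℕ.+ b)))
          where
          a = n ℕ.+ b
          1≤a : 1 ℕ.≤ a
          1≤a = ℕ.≤-trans 1≤b (ℕ.m≤n+m b n)
          2ᵃ = fromℕ 2 ^ a
          0≤2ᵃ = ^-nonneg (fromℕ-nonneg 2) a
          0≤2ᵇ = ^-nonneg (fromℕ-nonneg 2) b
          2ᵇ≤2ᵃ : 2ᵇ ≤ 2ᵃ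
          2ᵇ≤2ᵃ = ^-monoʳ-≤ (1≤fromℕ {2} (s≤s z≤n)) (ℕ.m≤n+m b n)
          δⁿ = fromℕ d ^ n
          0≤δⁿ = ^-nonneg (fromℕ-nonneg d) n

          -- As `a = n + b`, the exponent is `2n / a = 2 - 2b / a`, which `a ≤ p b` makes at most
          -- `2 - 2/p`: rounding `p` down is safe for the dimension factor.
          δⁿδⁿ≤Dᵃ : δⁿ * δⁿ ≤ D ^ a
          δⁿδⁿ≤Dᵃ = ≤-trans (≤-reflexive (sym (^-homo-* (fromℕ d) n n))) (d^≤D^ (n ℕ.+ n) a 1≤a (begin
            fromℕ (n ℕ.+ n)                              ≈⟨ fromℕ-+ n n ⟩
            fromℕ n + fromℕ n                            ≈⟨ solve 2 (λ n b → n :+ n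
                := :ℕ 2 :* (n :+ b) :- :ℕ 2 :* b)
                                                              refl (fromℕ n) (fromℕ b) ⟩
            fromℕ 2 * (fromℕ n + fromℕ b) - fromℕ 2 * fromℕ b
              ≤⟨ +-monoʳ-≤ _ (neg-mono-≤ (*-monoˡ-≤ (fromℕ-nonneg 2) (⁻¹-transposeˡ a≤pb))) ⟩
            fromℕ 2 * (fromℕ n + fromℕ b) - fromℕ 2 * (p ⁻¹ * fromℕ a)
              ≈⟨ +-congʳ (*-congˡ (fromℕ-+ n b)) ⟨
            fromℕ 2 * fromℕ a - fromℕ 2 * (p ⁻¹ * fromℕ a)
              ≈⟨ solve 2 (λ a q → :ℕ 2 :* a :- :ℕ 2 :* (q :* a) := (:ℕ 2 :- :ℕ 2 :* q) :* a)
                  refl (fromℕ a) (p ⁻¹) ⟩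
            (fromℕ 2 - fromℕ 2 * p ⁻¹) * fromℕ a         ∎))

          -- For `τ ≥ 1` only `b / (a + 1)` lies below `1 / p`; the spare factor `s` is then bounded
          -- by `S′ ≤ 2ᵇ`. The premise costs nothing: when `S′ ≤ s`, the desired comparison is
          -- immediate.
          τᵇ≤ : s ≤ S′ → τ ^ b ≤ 2ᵇ * s ^ a
          τᵇ≤ s≤S′ = by-size (total 1# τ)
            where
            by-size : 1# ≤ τ ⊎ τ ≤ 1# → τ ^ b ≤ 2ᵇ * s ^ a
            by-size (inj₁ 1≤τ) = begin
              τ ^ b
                ≤⟨ ^≤^ʳ^ b (suc a) 0≤τ (s≤s z≤n) (inj₁ (1≤τ , ⁻¹-transposeʳ pb≤1+a)) ⟩
              s ^ suc a        ≤⟨ *-monoʳ-≤ (^-nonneg 0≤s a) (≤-trans s≤S′ S′≤2ᵇ) ⟩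
              2ᵇ * s ^ a       ∎
            by-size (inj₂ τ≤1) = begin
              τ ^ b            ≤⟨ ^≤^ʳ^ b a 0≤τ 1≤a (inj₂ (τ≤1 , ⁻¹-transposeˡ a≤pb)) ⟩
              s ^ a            ≈⟨ *-identityˡ _ ⟨
              1# * s ^ a       ≤⟨ *-monoʳ-≤ (^-nonneg 0≤s a) (1≤^ (1≤fromℕ {2} (s≤s z≤n)) b) ⟩
              2ᵇ * s ^ a       ∎

          -- The 8 collects three factors 2: from `power-mean`, from `truncate^≤` and from `τᵇ≤`.
          -- The last two arise as `2ᵇ` and are enlarged to `2ᵃ`.
          S′ᵃ≤ : s ≤ S′ → S′ ^ a ≤ (fromℕ 8 * s) ^ a * δⁿ
          S′ᵃ≤ s≤S′ = begin
            S′ ^ a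
              ≤⟨ power-mean 1≤b n y (λ i → fromℕ 2 * x i ^ʳ p) 0≤y (λ i → *-nonneg (fromℕ-nonneg 2)
                  (0≤t i))
                   (λ i → truncate^≤ 1≤a 1≤b (0≤x i) 1≤2ᵇη a≤pb pb≤1+a) ⟩
            2ᵃ * (sum (λ i → fromℕ 2 * x i ^ʳ p) ^ b * δⁿ)
              ≈⟨ *-congˡ (*-congʳ (trans (^-congˡ b (sym (*-distribˡ-sum (fromℕ 2) (λ i → x i ^ʳ p))))
                  (*-^-distrib (fromℕ 2) τ b))) ⟩
            2ᵃ * (2ᵇ * τ ^ b * δⁿ)
              ≤⟨ *-monoˡ-≤ 0≤2ᵃ (*-monoʳ-≤ 0≤δⁿ (*-mono-≤ 0≤2ᵇ (^-nonneg 0≤τ b) 2ᵇ≤2ᵃ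
                   (≤-trans (τᵇ≤ s≤S′) (*-monoʳ-≤ (^-nonneg 0≤s a) 2ᵇ≤2ᵃ)))) ⟩
            2ᵃ * (2ᵃ * (2ᵃ * s ^ a) * δⁿ)
              ≈⟨ *-congˡ (*-congʳ (*-congˡ (*-^-distrib (fromℕ 2) s a))) ⟨
            2ᵃ * (2ᵃ * (fromℕ 2 * s) ^ a * δⁿ)
              ≈⟨ *-congˡ (*-congʳ (*-^-distrib (fromℕ 2) (fromℕ 2 * s) a)) ⟨
            2ᵃ * ((fromℕ 2 * (fromℕ 2 * s)) ^ a * δⁿ)
              ≈⟨ *-assoc _ _ _ ⟨
            2ᵃ * (fromℕ 2 * (fromℕ 2 * s)) ^ a * δⁿ
              ≈⟨ *-congʳ (*-^-distrib (fromℕ 2) (fromℕ 2 * (fromℕ 2 * s)) a) ⟨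
            (fromℕ 2 * (fromℕ 2 * (fromℕ 2 * s))) ^ a * δⁿ
              ≈⟨ *-congʳ (^-congˡ a (solve 1 (λ s → :ℕ 2 :* (:ℕ 2 :* (:ℕ 2 :* s)) := :ℕ 8 :* s) refl s)) ⟩
            (fromℕ 8 * s) ^ a * δⁿ
              ∎

          S′²≤ : S′ * S′ ≤ fromℕ 8 * s * (fromℕ 8 * s) * D
          S′²≤ = by-size (total s S′)
            where
            0≤8s = *-nonneg (fromℕ-nonneg 8) 0≤s
            q = fromℕ 8 * s
            qᵃ = q ^ a
            0≤qᵃ = ^-nonneg 0≤8s a
            by-size : s ≤ S′ ⊎ S′ ≤ s → S′ * S′ ≤ q * q * D
            by-size (inj₁ s≤S′) = ^-cancel-≤ a 1≤a (*-nonneg (*-nonneg 0≤8s 0≤8s) 0≤D) (begin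
              (S′ * S′) ^ a              ≈⟨ *-^-distrib S′ S′ a ⟩
              S′ ^ a * S′ ^ a
                ≤⟨ *-mono-≤ (^-nonneg 0≤S′ a) (^-nonneg 0≤S′ a) (S′ᵃ≤ s≤S′) (S′ᵃ≤ s≤S′) ⟩
              qᵃ * δⁿ * (qᵃ * δⁿ)
                ≈⟨ solve 2 (λ q δ → q :* δ :* (q :* δ) := q :* q :* (δ :* δ)) refl qᵃ δⁿ ⟩
              qᵃ * qᵃ * (δⁿ * δⁿ)        ≤⟨ *-monoˡ-≤ (*-nonneg 0≤qᵃ 0≤qᵃ) δⁿδⁿ≤Dᵃ ⟩
              qᵃ * qᵃ * D ^ a            ≈⟨ *-congʳ (*-^-distrib q q a) ⟨
              (q * q) ^ a * D ^ a        ≈⟨ *-^-distrib (q * q) D a ⟨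
              (q * q * D) ^ a            ∎)
            by-size (inj₂ S′≤s) = begin
              S′ * S′        ≤⟨ *-mono-≤ 0≤S′ 0≤S′ S′≤q S′≤q ⟩
              q * q          ≈⟨ *-identityʳ _ ⟨
              q * q * 1#     ≤⟨ *-monoˡ-≤ (*-nonneg 0≤8s 0≤8s) 1≤D ⟩
              q * q * D      ∎
              where
              S′≤q : S′ ≤ q
              S′≤q = ≤-trans S′≤s (≤-gap (fromℕ 7 * s) (solve 1 (λ s → :ℕ 8 :* s := s :+ :ℕ 7 :* s)
                  refl s)
                       (*-nonneg (fromℕ-nonneg 7) 0≤s))

          S²≤ : S * S ≤ rhs
          S²≤ = begin
            S * S
              ≤⟨ *-mono-≤ (proj₁ 0<S) (proj₁ 0<S) S≤2S′ S≤2S′ ⟩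
            fromℕ 2 * S′ * (fromℕ 2 * S′)
              ≈⟨ solve 1 (λ S → :ℕ 2 :* S :* (:ℕ 2 :* S) := :ℕ 4 :* (S :* S)) refl S′ ⟩
            fromℕ 4 * (S′ * S′)                     ≤⟨ *-monoˡ-≤ (fromℕ-nonneg 4) S′²≤ ⟩
            fromℕ 4 * (fromℕ 8 * s * (fromℕ 8 * s) * D)
              ≈⟨ solve 2 (λ s D → :ℕ 4 :* (:ℕ 8 :* s :* (:ℕ 8 :* s) :* D)
                  := :ℕ 16 :* s :* (:ℕ 16 :* s) :* D) refl s D ⟩
            rhs                                     ∎

        S²≤ : S * S ≤ rhs
        S²≤ = round (floor (*-nonneg (proj₁ 0<p) (fromℕ-nonneg b)))
          where
          round : Σ[ a ∈ ℕ ] fromℕ a ≤ p * fromℕ b × p * fromℕ b < fromℕ (suc a) → S * S ≤ rhs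
          round (a , a≤pb , pb<1+a) = Rounded.S²≤ {a ℕ.∸ b}
            (≤-trans (≤-reflexive (reflexive (≡.cong fromℕ a≡))) a≤pb)
            (≤-trans (proj₁ pb<1+a) (≤-reflexive (reflexive (≡.cong (fromℕ ∘ suc) (≡.sym a≡)))))
            where
            b≤a : b ℕ.≤ a
            b≤a = ℕ.s≤s⁻¹ (fromℕ-cancel-< (≤-<-trans (≤-trans (≤-reflexive (sym (*-identityˡ _)))
                    (*-monoʳ-≤ (fromℕ-nonneg b) 1≤p)) pb<1+a))
            a≡ : a ℕ.∸ b ℕ.+ b ≡ a
            a≡ = ℕ.m∸n+n≡m b≤a

      S²≤ : S * S ≤ rhs
      S²≤ = by-sign (0≤⇒0<⊎≈0 (sum-nonneg 0≤x))
        where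
        by-sign : 0# < S ⊎ S ≈ 0# → S * S ≤ rhs
        by-sign (inj₁ 0<S) = Positive.S²≤ 0<S
        by-sign (inj₂ S≈0) = ≤-trans (≤-reflexive (trans (*-congʳ S≈0) (zeroˡ S)))
          (*-nonneg (square-nonneg _) 0≤D)

  ∣x∣≈x : ∀ {x} → 0# ≤ x → ∣ x ∣ ≈ x
  ∣x∣≈x 0≤x = x≤y⇒y⊔x≈y (≤-trans (≤-trans (neg-mono-≤ 0≤x) (≤-reflexive (-0≈0))) 0≤x)
    where
    -0≈0 : - 0# ≈ 0#
    -0≈0 = solve 0 (:- :0 := :0) refl

  0≤∣x∣ : ∀ {x} → 0# ≤ x → 0# ≤ ∣ x ∣
  0≤∣x∣ 0≤x = ≤-trans 0≤x (≤-reflexive (sym (∣x∣≈x 0≤x)))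

  max-nonneg : ∀ {d} (x : Vector ℝ d) → 0# ≤ foldr _⊔_ 0# x
  max-nonneg {zero}  x = ≤-refl
  max-nonneg {suc d} x = ≤-trans (max-nonneg (x ∘ suc)) (x≤y⊔x _ _)

  ≤max : ∀ {d} (x : Vector ℝ d) i → x i ≤ foldr _⊔_ 0# x
  ≤max x zero    = x≤x⊔y _ _
  ≤max x (suc i) = ≤-trans (≤max (x ∘ suc) i) (x≤y⊔x _ _)

  dimensionFactor : ℕ → Exponent → ℝ
  dimensionFactor d p = fromℕ d ^ʳ (fromℕ 2 - fromℕ 2 * recip p)

  module _ {d : ℕ} (1≤d : 1 ℕ.≤ d) where

    d²≤D∞ : fromℕ d * fromℕ d ≤ dimensionFactor d ∞
    d²≤D∞ = begin
      fromℕ d * fromℕ d         ≈⟨ *-congˡ (*-identityʳ _) ⟨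
      fromℕ d ^ 2               ≤⟨ ^≤^ʳ^ 2 1 (fromℕ-nonneg d) ℕ.≤-refl (inj₁ (1≤fromℕ 1≤d ,
                                     ≤-reflexive (solve 0 (:ℕ 2 := (:ℕ 2 :- :ℕ 2 :* :0) :* :ℕ 1) refl))) ⟩
      dimensionFactor d ∞ ^ 1   ≈⟨ *-identityʳ _ ⟩
      dimensionFactor d ∞       ∎
      where open ≤-R

    1≤dimensionFactor : ∀ p → 1# ≤ dimensionFactor d p
    1≤dimensionFactor (finite p 1≤p) = PowerSum.1≤D 1≤p 1≤d (λ _ → 0#) (λ _ → ≤-refl)
    1≤dimensionFactor ∞ = ≤-trans (≤-reflexive (sym (*-identityˡ 1#)))
      (≤-trans (*-mono-≤ 0≤1 0≤1 (1≤fromℕ 1≤d) (1≤fromℕ 1≤d)) d²≤D∞)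

    ℓ-norm-nonneg : ∀ p (σ : Vector ℝ d) → (∀ i → 0# ≤ σ i) → 0# ≤ ℓ-norm p σ
    ℓ-norm-nonneg (finite p 1≤p) σ 0≤σ = PowerSum.0≤s 1≤p 1≤d (λ i → ∣ σ i ∣) (λ i → 0≤∣x∣ (0≤σ i))
    ℓ-norm-nonneg ∞              σ 0≤σ = max-nonneg (map ∣_∣ σ)

    sum²≤ℓ-norm² : ∀ p (σ : Vector ℝ d) → (∀ i → 0# ≤ σ i) →
      sum σ * sum σ ≤ fromℕ 16 * ℓ-norm p σ * (fromℕ 16 * ℓ-norm p σ) * dimensionFactor d p
    sum²≤ℓ-norm² (finite p 1≤p) σ 0≤σ = ≤-trans
      (≤-reflexive (*-cong sum≈ sum≈))
      (PowerSum.S²≤ 1≤p 1≤d (λ i → ∣ σ i ∣) (λ i → 0≤∣x∣ (0≤σ i)))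
      where
      sum≈ : sum σ ≈ sum (λ i → ∣ σ i ∣)
      sum≈ = sum-cong-≋ (λ i → sym (∣x∣≈x (0≤σ i)))
    sum²≤ℓ-norm² ∞ σ 0≤σ = begin
      sum σ * sum σ
        ≤⟨ *-mono-≤ (sum-nonneg 0≤σ) (sum-nonneg 0≤σ) sum≤ sum≤ ⟩
      fromℕ d * s * (fromℕ d * s)
        ≈⟨ solve 2 (λ d s → d :* s :* (d :* s) := s :* s :* (d :* d)) refl (fromℕ d) s ⟩
      s * s * (fromℕ d * fromℕ d)            ≤⟨ *-monoˡ-≤ (square-nonneg s) d²≤D∞ ⟩
      s * s * D
        ≤⟨ *-monoʳ-≤ (≤-trans 0≤1 (1≤dimensionFactor ∞)) (*-mono-≤ 0≤s 0≤s s≤16s s≤16s) ⟩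
      fromℕ 16 * s * (fromℕ 16 * s) * D      ∎
      where
      open ≤-R
      s = ℓ-norm ∞ σ
      D = dimensionFactor d ∞
      0≤s : 0# ≤ s
      0≤s = max-nonneg (map ∣_∣ σ)
      s≤16s : s ≤ fromℕ 16 * s
      s≤16s = ≤-gap (fromℕ 15 * s) (solve 1 (λ s → :ℕ 16 :* s := s :+ :ℕ 15 :* s)
          refl s) (*-nonneg (fromℕ-nonneg 15) 0≤s)
      sum≤ : sum σ ≤ fromℕ d * s
      sum≤ = ≤-trans (sum-mono-≤ (λ i → ≤-trans (≤-reflexive (sym (∣x∣≈x (0≤σ i)))) (≤max (map ∣_∣ σ) i)))
               (≤-reflexive (sum-const d))

-- Finite probability spaces.

module FiniteProbability (em : ExcludedMiddle 0ℓ) (R : RealNumbers) where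

  open Testing R
  open RingSolver R
  open OrderedField em R
  open Solver

  indicator : Set → ℝ
  indicator P = if does (em {P}) then 1# else 0#

  indicator-yes : ∀ {P} → P → indicator P ≈ 1#
  indicator-yes {P} p with em {P}
  ... | yes _ = refl
  ... | no ¬p = contradiction p ¬p

  indicator-no : ∀ {P} → ¬ P → indicator P ≈ 0#
  indicator-no {P} ¬p with em {P}
  ... | yes p = contradiction p ¬p
  ... | no _  = refl

  indicator-nonneg : ∀ P → 0# ≤ indicator P
  indicator-nonneg P with em {P}
  ... | yes _ = 0≤1
  ... | no _  = ≤-refl

  indicator-mono : ∀ {P Q} → (P → Q) → indicator P ≤ indicator Q
  indicator-mono {P} {Q} P→Q with em {P}
  ... | yes p = ≤-reflexive (sym (indicator-yes (P→Q p)))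
  ... | no _  = indicator-nonneg Q

  indicator-⊎ : ∀ {P Q} → ¬ (P × Q) → indicator P + indicator Q ≈ indicator (P ⊎ Q)
  indicator-⊎ {P} {Q} disjoint with em {P} | em {Q}
  ... | yes p | yes q = contradiction (p , q) disjoint
  ... | yes p | no ¬q = trans (+-identityʳ _) (sym (indicator-yes (inj₁ p)))
  ... | no ¬p | yes q = trans (+-identityˡ _) (sym (indicator-yes (inj₂ q)))
  ... | no ¬p | no ¬q = trans (+-identityˡ _) (sym (indicator-no λ { (inj₁ p) → ¬p p ; (inj₂ q) → ¬q q }))

  -- A finite probability space given by its expectation functional. Finiteness of `Ω` enters
  -- through `bounded`: numbers found at the single outcomes admit a common bound.
  record FiniteAverage (Ω : Set) : Set₁ where
    field
      𝔼       : (Ω → ℝ) → ℝ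
      𝔼-mono  : ∀ {f g} → (∀ ω → f ω ≤ g ω) → 𝔼 f ≤ 𝔼 g
      𝔼-+     : ∀ f g → 𝔼 (λ ω → f ω + g ω) ≈ 𝔼 f + 𝔼 g
      𝔼-*     : ∀ c f → 𝔼 (λ ω → c * f ω) ≈ c * 𝔼 f
      𝔼-1     : 𝔼 (λ _ → 1#) ≈ 1#
      bounded : (P : Ω → ℕ → Set) → (∀ ω → Σ[ n ∈ ℕ ] P ω n) →
                Σ[ N ∈ ℕ ] ∀ ω → Σ[ n ∈ ℕ ] n ℕ.< N × P ω n

    𝔼-cong : ∀ {f g} → (∀ ω → f ω ≈ g ω) → 𝔼 f ≈ 𝔼 g
    𝔼-cong f≈g = ≤-antisym (𝔼-mono (≤-reflexive ∘ f≈g)) (𝔼-mono (≤-reflexive ∘ sym ∘ f≈g))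

    𝔼-const : ∀ c → 𝔼 (λ _ → c) ≈ c
    𝔼-const c = begin
      𝔼 (λ _ → c)        ≈⟨ 𝔼-cong (λ _ → sym (*-identityʳ c)) ⟩
      𝔼 (λ _ → c * 1#)   ≈⟨ 𝔼-* c (λ _ → 1#) ⟩
      c * 𝔼 (λ _ → 1#)   ≈⟨ *-congˡ 𝔼-1 ⟩
      c * 1#             ≈⟨ *-identityʳ c ⟩
      c                  ∎
      where open import Relation.Binary.Reasoning.Setoid setoid

    𝔼-nonneg : ∀ {f} → (∀ ω → 0# ≤ f ω) → 0# ≤ 𝔼 f
    𝔼-nonneg 0≤f = ≤-trans (≤-reflexive (sym (𝔼-const 0#))) (𝔼-mono 0≤f)

    𝔼-sum : ∀ {n} (f : Fin n → Ω → ℝ) → 𝔼 (λ ω → sum (λ i → f i ω)) ≈ sum (λ i → 𝔼 (f i))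
    𝔼-sum {zero}  f = 𝔼-const 0#
    𝔼-sum {suc n} f = trans (𝔼-+ (f zero) _) (+-congˡ (𝔼-sum (f ∘ suc)))

  module _ {Ω : Set} (average : FiniteAverage Ω) where
    open FiniteAverage average

    ℙ : Pred Ω 0ℓ → ℝ
    ℙ E = 𝔼 (λ ω → indicator (E ω))

    Below : (ℕ → Pred Ω 0ℓ) → ℕ → Pred Ω 0ℓ
    Below E n ω = Σ[ i ∈ ℕ ] i ℕ.< n × E i ω

    indicator-Below : ∀ E → (∀ m n → m ≢ n → E m ⊥ E n) → ∀ n ω →
      sum {n} (λ i → indicator (E (toℕ i) ω)) ≈ indicator (Below E n ω)
    indicator-Below E disjoint zero    ω = sym (indicator-no λ { (_ , () , _) })
    indicator-Below E disjoint (suc n) ω = begin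
      indicator (E 0 ω) + sum {n} (λ i → indicator (E (suc (toℕ i)) ω))
        ≈⟨ +-congˡ (indicator-Below (E ∘ suc) (λ m n m≢n → disjoint (suc m) (suc n)
            (m≢n ∘ ≡.cong ℕ.pred)) n ω) ⟩
      indicator (E 0 ω) + indicator (Below (E ∘ suc) n ω)
        ≈⟨ indicator-⊎ (λ { (e₀ , i , _ , eᵢ) → disjoint 0 (suc i) (λ ()) (e₀ , eᵢ) }) ⟩
      indicator (E 0 ω ⊎ Below (E ∘ suc) n ω)
        ≈⟨ ≤-antisym (indicator-mono to) (indicator-mono from) ⟩
      indicator (Below E (suc n) ω) ∎
      where
      open import Relation.Binary.Reasoning.Setoid setoid
      to : E 0 ω ⊎ Below (E ∘ suc) n ω → Below E (suc n) ω
      to (inj₁ e)             = 0 , s≤s z≤n , e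
      to (inj₂ (i , i<n , e)) = suc i , s≤s i<n , e
      from : Below E (suc n) ω → E 0 ω ⊎ Below (E ∘ suc) n ω
      from (zero  , _       , e) = inj₁ e
      from (suc i , s≤s i<n , e) = inj₂ (i , i<n , e)

    probabilitySpace : ProbabilitySpace
    probabilitySpace = record
      { Ω          = Ω
      -- Excluded middle gives every predicate an indicator, hence a probability.
      ; IsEvent    = λ _ → ⊤
      ; μ          = ℙ
      ; event-resp = λ _ _ → tt
      ; event-U    = tt
      ; event-∁    = λ _ → tt
      ; event-⋃    = λ _ _ → tt
      ; μ-resp     = λ { (E⊆F , F⊆E) _ →
          ≤-antisym (𝔼-mono λ _ → indicator-mono E⊆F) (𝔼-mono λ _ → indicator-mono F⊆E) }
      ; μ-nonneg   = λ {E} _ → 𝔼-nonneg (λ ω → indicator-nonneg (E ω))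
      ; μ-U        = trans (𝔼-cong (λ _ → indicator-yes tt)) 𝔼-1
      ; μ-⋃        = λ E _ disjoint → additive E disjoint
      }
      where
      -- By `bounded`, the whole countable union is already covered by one finite partial union, so
      -- the supremum of the partial sums is attained.
      additive : ∀ E → (∀ m n → m ≢ n → E m ⊥ E n) →
        IsSupremum (λ s → Σ[ n ∈ ℕ ] s ≈ sum {n} (λ i → ℙ (E (toℕ i)))) (ℙ (⋃ ℕ E))
      additive E disjoint =
        (λ { s (n , s≈) → begin
          s                          ≈⟨ trans s≈ (partial n) ⟩
          ℙ (Below E n)              ≤⟨ 𝔼-mono (λ ω → indicator-mono λ { (i , _ , e) → i , e }) ⟩
          ℙ (⋃ ℕ E)                  ∎ }) ,
        λ b ub → begin
          ℙ (⋃ ℕ E)                  ≤⟨ 𝔼-mono (λ ω → indicator-mono (⋃⊆Below ω)) ⟩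
          ℙ (Below E N)              ≤⟨ ub _ (N , sym (partial N)) ⟩
          b                          ∎
        where
        open ≤-R
        partial : ∀ n → sum {n} (λ i → ℙ (E (toℕ i))) ≈ ℙ (Below E n)
        partial n = trans (sym (𝔼-sum {n} (λ i ω → indicator (E (toℕ i) ω))))
          (𝔼-cong (indicator-Below E disjoint n))
        Hit : Ω → ℕ → Set
        Hit ω n = ⋃ ℕ E ω → E n ω
        hit : ∀ ω → Σ[ n ∈ ℕ ] Hit ω n
        hit ω with em {⋃ ℕ E ω}
        ... | yes (n , e) = n , λ _ → e
        -- Outside the union `Hit` holds vacuously, so any index will do.
        ... | no ¬e       = 0 , λ e → contradiction e ¬e
        N = proj₁ (bounded Hit hit)
        ⋃⊆Below : ∀ ω → ⋃ ℕ E ω → Below E N ω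
        ⋃⊆Below ω e with proj₂ (bounded Hit hit) ω
        ... | n , n<N , e⇒ = n , n<N , e⇒ e

  -- Independent coins and the moments of sign vectors.

  ½ : ℝ
  ½ = fromℕ 2 ⁻¹

  ½*2z≈z : ∀ z → ½ * (fromℕ 2 * z) ≈ z
  ½*2z≈z z = trans (sym (*-assoc _ _ _))
    (trans (*-congʳ (trans (*-comm _ _) (⁻¹-inverseʳ _ (pos⇒≉0 (0<fromℕ-suc 1))))) (*-identityˡ z))

  0≤½ : 0# ≤ ½
  0≤½ = proj₁ (⁻¹-pos (0<fromℕ-suc 1))

  coin : FiniteAverage Bool
  coin = record
    { 𝔼       = λ f → ½ * (f true + f false)
    ; 𝔼-mono  = λ f≤g → *-monoˡ-≤ 0≤½ (+-mono-≤ (f≤g true) (f≤g false))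
    ; 𝔼-+     = λ f g → solve 5 (λ h a b c d → h :* (a :+ b :+ (c :+ d))
        := h :* (a :+ c) :+ h :* (b :+ d))
                  refl ½ (f true) (g true) (f false) (g false)
    ; 𝔼-*     = λ c f → solve 4 (λ h c a b → h :* (c :* a :+ c :* b) := c :* (h :* (a :+ b)))
                  refl ½ c (f true) (f false)
    ; 𝔼-1     = trans (solve 1 (λ h → h :* (:1 :+ :1) := h :* (:ℕ 2 :* :1)) refl ½) (½*2z≈z 1#)
    ; bounded = λ P p → suc (proj₁ (p true) ℕ.⊔ proj₁ (p false)) , λ
        { true  → proj₁ (p true)  , s≤s (ℕ.m≤m⊔n _ _) , proj₂ (p true)
        ; false → proj₁ (p false) , s≤s (ℕ.m≤n⊔m (proj₁ (p true)) _) , proj₂ (p false) }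
    }

  module _ {Ω : Set} (average : FiniteAverage Ω) where
    open FiniteAverage average

    independent : ∀ k → FiniteAverage (Vec Ω k)
    independent zero = record
      { 𝔼       = λ f → f []
      ; 𝔼-mono  = λ f≤g → f≤g []
      ; 𝔼-+     = λ _ _ → refl
      ; 𝔼-*     = λ _ _ → refl
      ; 𝔼-1     = refl
      ; bounded = λ P p → suc (proj₁ (p [])) , λ { [] → proj₁ (p []) , ℕ.≤-refl , proj₂ (p []) }
      }
    independent (suc k) = record
      { 𝔼       = λ f → 𝔼 (λ ω → Tail.𝔼 (λ ωs → f (ω ∷ ωs)))
      ; 𝔼-mono  = λ f≤g → 𝔼-mono (λ ω → Tail.𝔼-mono (λ ωs → f≤g (ω ∷ ωs)))
      ; 𝔼-+     = λ f g → trans (𝔼-cong (λ ω → Tail.𝔼-+ _ _)) (𝔼-+ _ _)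
      ; 𝔼-*     = λ c f → trans (𝔼-cong (λ ω → Tail.𝔼-* c _)) (𝔼-* c _)
      ; 𝔼-1     = trans (𝔼-cong (λ ω → Tail.𝔼-1)) 𝔼-1
      ; bounded = λ P p → let
            N : Ω → ℕ → Set
            N ω m = ∀ ωs → Σ[ n ∈ ℕ ] n ℕ.< m × P (ω ∷ ωs) n
            -- The bound for the tail depends on the first coordinate; a second use of `bounded`
            -- makes it uniform.
            outer = bounded N (λ ω → Tail.bounded (λ ωs → P (ω ∷ ωs)) (λ ωs → p (ω ∷ ωs)))
          in proj₁ outer , λ { (ω ∷ ωs) → let
              (m , m<M , uniform) = proj₂ outer ω
              (n , n<m , q) = uniform ωs
            in n , ℕ.<-trans n<m m<M , q }
      }
      where module Tail = FiniteAverage (independent k)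

    module _ (h : Ω → ℝ) (𝔼h≈0 : 𝔼 h ≈ 0#) {c : ℝ} (𝔼h²≤c : 𝔼 (λ ω → h ω * h ω) ≤ c) where

      total-deviation : ∀ {k} → Vec Ω k → ℝ
      total-deviation {k} ωs = sum {k} (λ j → h (lookup ωs j))

      𝔼-total : ∀ k → FiniteAverage.𝔼 (independent k) total-deviation ≈ 0#
      𝔼-total zero    = refl
      𝔼-total (suc k) = begin
        𝔼 (λ ω → Tail.𝔼 (λ ωs → h ω + total-deviation ωs))
          ≈⟨ 𝔼-cong (λ ω → trans (Tail.𝔼-+ _ _) (+-cong (Tail.𝔼-const _) (𝔼-total k))) ⟩
        𝔼 (λ ω → h ω + 0#)
          ≈⟨ 𝔼-cong (λ ω → +-identityʳ _) ⟩
        𝔼 h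
          ≈⟨ 𝔼h≈0 ⟩
        0# ∎
        where
        open import Relation.Binary.Reasoning.Setoid setoid
        module Tail = FiniteAverage (independent k)

      -- Once the first outcome is fixed, the cross term is a constant times the total of the
      -- others, whose mean is zero; so second moments add.
      variance-total : ∀ k →
        FiniteAverage.𝔼 (independent k) (λ ωs → total-deviation ωs * total-deviation ωs) ≤ fromℕ k * c
      variance-total zero    = ≤-reflexive (solve 1 (λ c → :0 :* :0 := :0 :* c) refl c)
      variance-total (suc k) = begin
        𝔼 (λ ω → Tail.𝔼 (λ ωs → (h ω + H ωs) * (h ω + H ωs)))
          ≈⟨ 𝔼-cong (λ ω → expand (h ω)) ⟩
        𝔼 (λ ω → h ω * h ω + Tail.𝔼 (λ ωs → H ωs * H ωs))
          ≈⟨ trans (𝔼-+ _ _) (+-congˡ (𝔼-const _)) ⟩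
        𝔼 (λ ω → h ω * h ω) + Tail.𝔼 (λ ωs → H ωs * H ωs)
          ≤⟨ +-mono-≤ 𝔼h²≤c (variance-total k) ⟩
        c + fromℕ k * c
          ≈⟨ solve 2 (λ k c → c :+ k :* c := (:1 :+ k) :* c) refl (fromℕ k) c ⟩
        fromℕ (suc k) * c ∎
        where
        open ≤-R
        module Tail = FiniteAverage (independent k)
        H : Vec Ω k → ℝ
        H = total-deviation
        expand : ∀ x → Tail.𝔼 (λ ωs → (x + H ωs) * (x + H ωs)) ≈ x * x + Tail.𝔼 (λ ωs → H ωs * H ωs)
        expand x = begin-equality
          Tail.𝔼 (λ ωs → (x + H ωs) * (x + H ωs))
            ≈⟨ Tail.𝔼-cong (λ ωs → solve 2 (λ x H → (x :+ H) :* (x :+ H)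
                := x :* x :+ ((x :+ x) :* H :+ H :* H)) refl x (H ωs)) ⟩
          Tail.𝔼 (λ ωs → x * x + ((x + x) * H ωs + H ωs * H ωs))
            ≈⟨ trans (Tail.𝔼-+ _ _) (+-cong (Tail.𝔼-const _) (Tail.𝔼-+ _ _)) ⟩
          x * x + (Tail.𝔼 (λ ωs → (x + x) * H ωs) + Tail.𝔼 (λ ωs → H ωs * H ωs))
            ≈⟨ +-congˡ (+-congʳ (trans (Tail.𝔼-* _ _) (trans (*-congˡ (𝔼-total k)) (zeroʳ _)))) ⟩
          x * x + (0# + Tail.𝔼 (λ ωs → H ωs * H ωs))
            ≈⟨ +-congˡ (+-identityˡ _) ⟩
          x * x + Tail.𝔼 (λ ωs → H ωs * H ωs) ∎

  sign : Bool → ℝ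
  sign true  = 1#
  sign false = - 1#

  signs : ∀ {d} → Vec Bool d → Vector ℝ d
  signs bs i = sign (lookup bs i)

  coins : ∀ d → FiniteAverage (Vec Bool d)
  coins = independent coin

  module Signs d = FiniteAverage (coins d)

  -- Averages out the first sign: terms odd in it cancel between its two values, and `G` is what
  -- remains.
  signs-step : ∀ {d} (F : Vec Bool (suc d) → ℝ) (G : Vec Bool d → ℝ) →
    (∀ bs → F (true ∷ bs) + F (false ∷ bs) ≈ fromℕ 2 * G bs) → Signs.𝔼 (suc d) F ≈ Signs.𝔼 d G
  signs-step {d} F G eq = begin
    ½ * (𝔼 (λ bs → F (true ∷ bs)) + 𝔼 (λ bs → F (false ∷ bs)))   ≈⟨ *-congˡ (𝔼-+ _ _) ⟨
    ½ * 𝔼 (λ bs → F (true ∷ bs) + F (false ∷ bs))                ≈⟨ *-congˡ (𝔼-cong eq) ⟩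
    ½ * 𝔼 (λ bs → fromℕ 2 * G bs)                                ≈⟨ *-congˡ (𝔼-* _ _) ⟩
    ½ * (fromℕ 2 * 𝔼 G)                                          ≈⟨ ½*2z≈z _ ⟩
    𝔼 G                                                          ∎
    where
    open import Relation.Binary.Reasoning.Setoid setoid
    open Signs d

  𝔼-signs² : ∀ {d} (u v : Vector ℝ d) → Signs.𝔼 d (λ g → (signs g ∙ u) * (signs g ∙ v)) ≈ u ∙ v
  𝔼-signs² {zero}  u v = zeroˡ 0#
  𝔼-signs² {suc d} u v = begin
    Signs.𝔼 (suc d) (λ g → (signs g ∙ u) * (signs g ∙ v))
      ≈⟨ signs-step (λ g → (signs g ∙ u) * (signs g ∙ v)) (λ g → u₀ * v₀ + (signs g ∙ u′) *
          (signs g ∙ v′)) (λ g →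
           solve 4 (λ u v U V → (:1 :* u :+ U) :* (:1 :* v :+ V) :+ (:- :1 :* u :+ U) :* (:- :1 :* v :+ V)
             := :ℕ 2 :* (u :* v :+ U :* V)) refl u₀ v₀ (signs g ∙ u′) (signs g ∙ v′)) ⟩
    𝔼 (λ g → u₀ * v₀ + (signs g ∙ u′) * (signs g ∙ v′))
      ≈⟨ trans (𝔼-+ _ _) (+-cong (𝔼-const _) (𝔼-signs² u′ v′)) ⟩
    u₀ * v₀ + u′ ∙ v′ ∎
    where
    open import Relation.Binary.Reasoning.Setoid setoid
    open Signs d
    u₀ = u zero
    v₀ = v zero
    u′ v′ : Vector ℝ d
    u′ = u ∘ suc
    v′ = v ∘ suc

  -- The right side is the exact value for standard Gaussian vectors. A sign has fourth moment 1
  -- instead of 3, so each coordinate falls short by `2 * (u i * v i)²`; this is the gap given away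
  -- at each step.
  𝔼-signs⁴ : ∀ {d} (u v : Vector ℝ d) →
    Signs.𝔼 d (λ g → (signs g ∙ u) * (signs g ∙ v) * ((signs g ∙ u) * (signs g ∙ v)))
      ≤ (u ∙ u) * (v ∙ v) + fromℕ 2 * ((u ∙ v) * (u ∙ v))
  𝔼-signs⁴ {zero}  u v = ≤-reflexive (solve 0
    (:0 :* :0 :* (:0 :* :0) := :0 :* :0 :+ :ℕ 2 :* (:0 :* :0)) refl)
  𝔼-signs⁴ {suc d} u v = begin
    Signs.𝔼 (suc d) (λ g → (signs g ∙ u) * (signs g ∙ v) * ((signs g ∙ u) * (signs g ∙ v)))
      ≈⟨ signs-step (λ g → (signs g ∙ u) * (signs g ∙ v) * ((signs g ∙ u) * (signs g ∙ v))) G (λ g →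
           solve 4 (λ u v U V → (:1 :* u :+ U) :* (:1 :* v :+ V) :* ((:1 :* u :+ U) :* (:1 :* v :+ V))
               :+ (:- :1 :* u :+ U) :* (:- :1 :* v :+ V) :* ((:- :1 :* u :+ U) :* (:- :1 :* v :+ V))
             := :ℕ 2 :* (u :* v :* (u :* v) :+ (u :* u :* (V :* V) :+ (v :* v :* (U :* U)
                  :+ (:ℕ 4 :* (u :* v) :* (U :* V) :+ U :* V :* (U :* V))))))
             refl u₀ v₀ (U g) (V g)) ⟩
    𝔼 G
      ≈⟨ trans (𝔼-+ _ _) (+-cong (𝔼-const _) (trans (𝔼-+ _ _) (+-cong (𝔼-* _ _) (trans (𝔼-+ _ _)
           (+-cong (𝔼-* _ _) (trans (𝔼-+ _ _) (+-congʳ (𝔼-* _ _)))))))) ⟩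
    u₀ * v₀ * (u₀ * v₀) + (u₀ * u₀ * 𝔼 (λ g → V g * V g) + (v₀ * v₀ * 𝔼 (λ g → U g * U g)
      + (fromℕ 4 * (u₀ * v₀) * 𝔼 (λ g → U g * V g) + 𝔼 (λ g → U g * V g * (U g * V g)))))
      ≈⟨ +-congˡ (+-cong (*-congˡ (𝔼-signs² v′ v′)) (+-cong (*-congˡ (𝔼-signs² u′ u′)) (+-congʳ
          (*-congˡ (𝔼-signs² u′ v′))))) ⟩
    u₀ * v₀ * (u₀ * v₀) + (u₀ * u₀ * (v′ ∙ v′) + (v₀ * v₀ * (u′ ∙ u′)
      + (fromℕ 4 * (u₀ * v₀) * (u′ ∙ v′) + 𝔼 (λ g → U g * V g * (U g * V g)))))
      ≤⟨ +-monoʳ-≤ _ (+-monoʳ-≤ _ (+-monoʳ-≤ _ (+-monoʳ-≤ _ (𝔼-signs⁴ u′ v′)))) ⟩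
    u₀ * v₀ * (u₀ * v₀) + (u₀ * u₀ * (v′ ∙ v′) + (v₀ * v₀ * (u′ ∙ u′)
      + (fromℕ 4 * (u₀ * v₀) * (u′ ∙ v′) + ((u′ ∙ u′) * (v′ ∙ v′) + fromℕ 2 * ((u′ ∙ v′) * (u′ ∙ v′))))))
      ≤⟨ ≤-gap (fromℕ 2 * (u₀ * v₀ * (u₀ * v₀)))
           (solve 5 (λ u v uu vv uv →
               (u :* u :+ uu) :* (v :* v :+ vv) :+ :ℕ 2 :* ((u :* v :+ uv) :* (u :* v :+ uv))
             := u :* v :* (u :* v) :+ (u :* u :* vv :+ (v :* v :* uu :+ (:ℕ 4 :* (u :* v) :* uv
                  :+ (uu :* vv :+ :ℕ 2 :* (uv :* uv))))) :+ :ℕ 2 :* (u :* v :* (u :* v)))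
             refl u₀ v₀ (u′ ∙ u′) (v′ ∙ v′) (u′ ∙ v′))
           (*-nonneg (fromℕ-nonneg 2) (square-nonneg (u₀ * v₀))) ⟩
    (u ∙ u) * (v ∙ v) + fromℕ 2 * ((u ∙ v) * (u ∙ v)) ∎
    where
    open ≤-R
    open Signs d
    u₀ = u zero
    v₀ = v zero
    u′ v′ : Vector ℝ d
    u′ = u ∘ suc
    v′ = v ∘ suc
    U V G : Vec Bool d → ℝ
    U g = signs g ∙ u′
    V g = signs g ∙ v′
    G g = u₀ * v₀ * (u₀ * v₀) + (u₀ * u₀ * (V g * V g) + (v₀ * v₀ * (U g * U g)
      + (fromℕ 4 * (u₀ * v₀) * (U g * V g) + U g * V g * (U g * V g))))

-- Bilinear forms on random combinations of vectors.

module Sketching (em : ExcludedMiddle 0ℓ) (R : RealNumbers) where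

  open Testing R
  open RingSolver R
  open OrderedField em R
  open FiniteProbability em R
  open import Algebra.Properties.Semiring.Sum semiring using (*-distribˡ-sum; *-distribʳ-sum)
  open import Algebra.Properties.CommutativeMonoid.Sum +-commutativeMonoid
    using (sum-cong-≋; ∑-distrib-+; ∑-comm)
  open Solver

  module _ {d : ℕ} where

    ∙-congˡ : ∀ {u v w : Vector ℝ d} → v ≋ w → u ∙ v ≈ u ∙ w
    ∙-congˡ v≋w = sum-cong-≋ (λ i → *-congˡ (v≋w i))

    ∙-congʳ : ∀ {u v w : Vector ℝ d} → v ≋ w → v ∙ u ≈ w ∙ u
    ∙-congʳ v≋w = sum-cong-≋ (λ i → *-congʳ (v≋w i))

    ∙-comm : ∀ (u v : Vector ℝ d) → u ∙ v ≈ v ∙ u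
    ∙-comm u v = sum-cong-≋ (λ i → *-comm (u i) (v i))

    ∙-linear₂ : ∀ a b (u w v : Vector ℝ d) →
      (λ i → a * u i + b * w i) ∙ v ≈ a * (u ∙ v) + b * (w ∙ v)
    ∙-linear₂ a b u w v = begin
      sum (λ i → (a * u i + b * w i) * v i)
        ≈⟨ sum-cong-≋ (λ i → solve 5 (λ a b u w v → (a :* u :+ b :* w) :* v
            := a :* (u :* v) :+ b :* (w :* v))
             refl a b (u i) (w i) (v i)) ⟩
      sum (λ i → a * (u i * v i) + b * (w i * v i))
        ≈⟨ ∑-distrib-+ (λ i → a * (u i * v i)) (λ i → b * (w i * v i)) ⟩
      sum (λ i → a * (u i * v i)) + sum (λ i → b * (w i * v i))
        ≈⟨ +-cong (*-distribˡ-sum a (λ i → u i * v i)) (*-distribˡ-sum b (λ i → w i * v i)) ⟨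
      a * (u ∙ v) + b * (w ∙ v) ∎
      where open import Relation.Binary.Reasoning.Setoid setoid

    combination : ∀ {k} → Vector ℝ k → (Fin k → Vector ℝ d) → Vector ℝ d
    combination c G i = sum (λ j → c j * G j i)

    combination-∙ : ∀ {k} (c : Vector ℝ k) (G : Fin k → Vector ℝ d) v →
      combination c G ∙ v ≈ sum (λ j → c j * (G j ∙ v))
    combination-∙ {k} c G v = begin
      sum (λ i → sum (λ j → c j * G j i) * v i)
        ≈⟨ sum-cong-≋ (λ i → *-distribʳ-sum (v i) (λ j → c j * G j i)) ⟩
      sum (λ i → sum (λ j → c j * G j i * v i))
        ≈⟨ ∑-comm (λ i j → c j * G j i * v i) ⟩
      sum (λ j → sum (λ i → c j * G j i * v i))
        ≈⟨ sum-cong-≋ (λ j → sum-cong-≋ (λ i → *-assoc (c j) (G j i) (v i))) ⟩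
      sum (λ j → sum (λ i → c j * (G j i * v i)))
        ≈⟨ sum-cong-≋ (λ j → *-distribˡ-sum (c j) (λ i → G j i * v i)) ⟨
      sum (λ j → c j * (G j ∙ v)) ∎
      where open import Relation.Binary.Reasoning.Setoid setoid

    bilinear : Matrix d → Vector ℝ d → Vector ℝ d → ℝ
    bilinear A u v = u ∙ (A *ᵥ v)

    bilinear-sym : ∀ {A} → IsSymmetric A → ∀ u v → bilinear A u v ≈ bilinear A v u
    bilinear-sym {A} A-sym u v = begin
      sum (λ i → u i * sum (λ j → A i j * v j))
        ≈⟨ sum-cong-≋ (λ i → *-distribˡ-sum (u i) (λ j → A i j * v j)) ⟩
      sum (λ i → sum (λ j → u i * (A i j * v j)))
        ≈⟨ ∑-comm (λ i j → u i * (A i j * v j)) ⟩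
      sum (λ j → sum (λ i → u i * (A i j * v j)))
        ≈⟨ sum-cong-≋ (λ j → sum-cong-≋ (λ i → trans (*-congˡ (*-congʳ (A-sym i j)))
             (solve 3 (λ u a v → u :* (a :* v) := v :* (a :* u)) refl (u i) (A j i) (v j)))) ⟩
      sum (λ j → sum (λ i → v j * (A j i * u i)))
        ≈⟨ sum-cong-≋ (λ j → *-distribˡ-sum (v j) (λ i → A j i * u i)) ⟨
      sum (λ j → v j * sum (λ i → A j i * u i)) ∎
      where open import Relation.Binary.Reasoning.Setoid setoid

    bilinear-combination : ∀ {A k} → IsSymmetric A → (z : Vector ℝ k) (G : Fin k → Vector ℝ d) →
      bilinear A (combination z G) (combination z G) ≈
        sum (λ a → sum (λ b → z a * z b * bilinear A (G a) (G b)))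
    bilinear-combination {A} {k} A-sym z G = begin
      bilinear A y y
        ≈⟨ combination-∙ z G _ ⟩
      sum (λ a → z a * bilinear A (G a) y)
        ≈⟨ sum-cong-≋ (λ a → *-congˡ {z a} (trans (bilinear-sym A-sym (G a) y) (combination-∙ z G _))) ⟩
      sum (λ a → z a * sum (λ b → z b * bilinear A (G b) (G a)))
        ≈⟨ sum-cong-≋ (λ a → *-distribˡ-sum (z a) (λ b → z b * bilinear A (G b) (G a))) ⟩
      sum (λ a → sum (λ b → z a * (z b * bilinear A (G b) (G a))))
        ≈⟨ sum-cong-≋ (λ a → sum-cong-≋ (λ b → trans (sym (*-assoc (z a) (z b) _))
             (*-congˡ (bilinear-sym A-sym (G b) (G a))))) ⟩
      sum (λ a → sum (λ b → z a * z b * bilinear A (G a) (G b))) ∎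
      where
      open import Relation.Binary.Reasoning.Setoid setoid
      y = combination z G

    0<v∙v : ∀ {v : Vector ℝ d} → ¬ (∀ i → v i ≈ 0#) → 0# < v ∙ v
    0<v∙v {v} v≉0 = ≰⇒> λ v∙v≤0 → v≉0 (all≈0 v∙v≤0)
      where
      all≈0 : v ∙ v ≤ 0# → ∀ i → v i ≈ 0#
      all≈0 v∙v≤0 i with em {v i ≈ 0#}
      ... | yes vᵢ≈0 = vᵢ≈0
      ... | no  vᵢ≉0 = x*y≈0⇒y≈0 vᵢ≉0 (≤-antisym
        (≤-trans (term≤sum {f = λ i → v i * v i} (λ i → square-nonneg (v i)) i) v∙v≤0) (square-nonneg
            (v i)))

    column : Matrix d → Fin d → Vector ℝ d
    column P m i = P i m

    column-norm : ∀ {P} → IsOrthogonal P → ∀ m → column P m ∙ column P m ≈ 1#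
    column-norm {P} (orthonormal , _) m = trans (orthonormal m m) diagonal
      where
      diagonal : identity {d} m m ≈ 1#
      diagonal with m ≟ m
      ... | yes _  = refl
      ... | no m≢m = contradiction ≡.refl m≢m

    -- The decomposition is the one contained in `AreSingularValues`. It reduces the quadratic form
    -- to scalar products with single columns, whose second moments are bounded later.
    bilinear-SVD : ∀ {A P Q : Matrix d} {σ : Vector ℝ d} →
      (∀ i j → A i j ≈ sum (λ m → P i m * σ m * Q j m)) →
      ∀ w → bilinear A w w ≈ sum (λ m → σ m * (column Q m ∙ w) * (column P m ∙ w))
    bilinear-SVD {A} {P} {Q} {σ} A≈ w = begin
      w ∙ (A *ᵥ w)                      ≈⟨ ∙-congˡ {w} image ⟩
      w ∙ combination c (column P)      ≈⟨ ∙-comm w _ ⟩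
      combination c (column P) ∙ w      ≈⟨ combination-∙ c (column P) w ⟩
      sum (λ m → c m * (column P m ∙ w)) ∎
      where
      open import Relation.Binary.Reasoning.Setoid setoid
      c : Vector ℝ d
      c m = σ m * (column Q m ∙ w)
      image : (A *ᵥ w) ≋ combination c (column P)
      image i = begin
        A i ∙ w                                                   ≈⟨ ∙-congʳ {w} (A≈ i) ⟩
        combination (λ m → P i m * σ m) (column Q) ∙ w
          ≈⟨ combination-∙ (λ m → P i m * σ m) (column Q) w ⟩
        sum (λ m → P i m * σ m * (column Q m ∙ w))                ≈⟨ sum-cong-≋ (λ m → solve 3
            (λ p s q → p :* s :* q := s :* q :* p)
                                                                       refl (P i m) (σ m) (column Q m ∙ w)) ⟩
        combination c (column P) i                                ∎

  does-⇔ : ∀ {P Q : Set} → (P → Q) → (Q → P) → does (em {P}) ≡ does (em {Q})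
  does-⇔ {P} {Q} to from with em {P} | em {Q}
  ... | yes _ | yes _ = ≡.refl
  ... | no _  | no _  = ≡.refl
  ... | yes p | no ¬q = contradiction (to p) ¬q
  ... | no ¬p | yes q = contradiction (from q) ¬p

  ¬⇒does≡false : ∀ {P : Set} → ¬ P → does (em {P}) ≡ false
  ¬⇒does≡false {P} ¬p with em {P}
  ... | yes p = contradiction p ¬p
  ... | no _  = ≡.refl

  does≡false⇒¬ : ∀ {P : Set} → does (em {P}) ≡ false → ¬ P
  does≡false⇒¬ {P} eq with em {P}
  does≡false⇒¬ {P} ()  | yes _
  does≡false⇒¬ {P} _   | no ¬p = ¬p

  -- The sketching algorithm and its error probability.

  module Sketch (d k : ℕ) where

    Ω : Set
    Ω = Vec (Vec Bool d) k

    average : FiniteAverage Ω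
    average = independent (coins d) k

    G : Ω → Fin k → Vector ℝ d
    G ω j = signs (lookup ω j)

    form : Vector ℝ (k ℕ.* k) → Vector ℝ k → ℝ
    form M z = sum (λ a → sum (λ b → z a * z b * M (combine a b)))

    Indefinite : Vector ℝ (k ℕ.* k) → Set
    Indefinite M = Σ[ z ∈ Vector ℝ k ] form M z < 0#

    Indefinite-resp : ∀ {M N} → M ≋ N → Indefinite M → Indefinite N
    Indefinite-resp M≋N (z , form<0) = z , ≤-<-trans (≤-reflexive (sym
      (sum-cong-≋ (λ a → sum-cong-≋ (λ b → *-congˡ {z a * z b} (M≋N (combine a b))))))) form<0

    pair : Ω → Fin k × Fin k → Vector ℝ d × Vector ℝ d
    pair ω (a , b) = G ω a , G ω b

    sketch : NonAdaptiveAlgorithm d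
    sketch = record
      { coins             = probabilitySpace average
      ; #queries          = λ _ → k ℕ.* k
      ; queries           = λ ω q → pair ω (remQuot k q)
      -- Computation is free, so the existence of a negative direction is decided by excluded
      -- middle.
      ; decide            = λ _ M → not (does (em {Indefinite M}))
      ; decide-cong       = λ _ M≋N → ≡.cong not
          (does-⇔ (Indefinite-resp M≋N) (Indefinite-resp (λ i → sym (M≋N i))))
      ; output-measurable = λ _ _ _ → tt
      }

    open NonAdaptiveAlgorithm sketch using (answers; output; Outputs)

    form-answers : ∀ {A} → IsSymmetric A → ∀ ω z →
      form (answers A ω) z ≈ bilinear A (combination z (G ω)) (combination z (G ω))
    form-answers {A} A-sym ω z = trans
      (sum-cong-≋ (λ a → sum-cong-≋ (λ b → *-congˡ {z a * z b} (reflexive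
        (≡.cong (λ ab → bilinear A (G ω (proj₁ ab)) (G ω (proj₂ ab))) (remQuot-combine a b))))))
      (sym (bilinear-combination A-sym z (G ω)))

    -- A negative direction `z` of the answers gives an actual vector, `combination z (G ω)`, on
    -- which the form of `A` is negative.
    output-PSD : ∀ {A} → IsSymmetric A → IsPSD A → ∀ ω → output A ω ≡ true
    output-PSD {A} A-sym A-psd ω = ≡.cong not (¬⇒does≡false {Indefinite (answers A ω)}
      λ { (z , form<0) → <⇒≱ form<0
        (≤-trans (A-psd (combination z (G ω))) (≤-reflexive (sym (form-answers A-sym ω z)))) })

    accepted⇒nonneg : ∀ {A} → IsSymmetric A → ∀ ω z → output A ω ≡ true →
      0# ≤ bilinear A (combination z (G ω)) (combination z (G ω))
    accepted⇒nonneg {A} A-sym ω z eq = ≮⇒≥ λ neg → does≡false⇒¬ {Indefinite (answers A ω)}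
      (not-injective eq) (z , ≤-<-trans (≤-reflexive (form-answers A-sym ω z)) neg)
      where
      not-injective : ∀ {b} → not b ≡ true → b ≡ false
      not-injective {false} _ = ≡.refl

    ℙ-true+ℙ-false : ∀ A → ℙ average (Outputs A true) + ℙ average (Outputs A false) ≈ 1#
    ℙ-true+ℙ-false A = begin
      ℙ average (Outputs A true) + ℙ average (Outputs A false)
        ≈⟨ 𝔼-+ _ _ ⟨
      𝔼 (λ ω → indicator (Outputs A true ω) + indicator (Outputs A false ω))
        ≈⟨ 𝔼-cong (λ ω → trans (indicator-⊎ (λ { (t , f) → true≢false (≡.trans (≡.sym t) f) }))
             (indicator-yes (cases (output A ω)))) ⟩
      𝔼 (λ ω → 1#)
        ≈⟨ 𝔼-1 ⟩
      1# ∎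
      where
      open FiniteAverage average
      open import Relation.Binary.Reasoning.Setoid setoid
      true≢false : ¬ true ≡ false
      true≢false ()
      cases : ∀ b → b ≡ true ⊎ b ≡ false
      cases true  = inj₁ ≡.refl
      cases false = inj₂ ≡.refl

    -- The test vector is y = Σⱼ ⟨gⱼ,v⟩ gⱼ, and w is n times its component orthogonal to v.
    module Far {A P Q : Matrix d} {σ v : Vector ℝ d} {l e : ℝ}
      (A-sym : IsSymmetric A)
      (Av≋lv : (A *ᵥ v) ≋ (λ i → l * v i))
      (v≉0 : ¬ (∀ i → v i ≈ 0#))
      (0≤σ : ∀ m → 0# ≤ σ m)
      (P-orth : IsOrthogonal P) (Q-orth : IsOrthogonal Q)
      (A≈ : ∀ i j → A i j ≈ sum (λ m → P i m * σ m * Q j m))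
      (0<e : 0# < e) (l≤-e : l ≤ - e)
      where

      open FiniteAverage average

      S n κ : ℝ
      S = sum σ
      n = v ∙ v
      κ = fromℕ k

      0<n : 0# < n
      0<n = 0<v∙v v≉0

      x : Ω → Vector ℝ k
      x ω j = G ω j ∙ v

      α : Ω → ℝ
      α ω = x ω ∙ x ω

      y w : Ω → Vector ℝ d
      y ω = combination (x ω) (G ω)
      w ω i = n * y ω i + (- α ω) * v i

      y∙v≈α : ∀ ω → y ω ∙ v ≈ α ω
      y∙v≈α ω = combination-∙ (x ω) (G ω) v

      bilinear-v : ∀ u → bilinear A u v ≈ l * (u ∙ v)
      bilinear-v u = begin
        u ∙ (A *ᵥ v)                 ≈⟨ ∙-congˡ {u = u} Av≋lv ⟩
        sum (λ i → u i * (l * v i))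
          ≈⟨ sum-cong-≋ (λ i → solve 3 (λ u l v → u :* (l :* v) := l :* (u :* v)) refl (u i) l (v i)) ⟩
        sum (λ i → l * (u i * v i))  ≈⟨ *-distribˡ-sum l (λ i → u i * v i) ⟨
        l * (u ∙ v)                  ∎
        where open import Relation.Binary.Reasoning.Setoid setoid

      -- In `n y = w + α v` the summands are orthogonal and `v` is an eigenvector. The cross terms
      -- are therefore multiples of `w ∙ v = 0`, and the part along `v` contributes `n l α²`.
      bilinear-w : ∀ ω → bilinear A (w ω) (w ω) ≈ n * n * bilinear A (y ω) (y ω) - n * l * (α ω * α ω)
      bilinear-w ω = begin
        bilinear A w′ w′
          ≈⟨ ∙-linear₂ n (- a) y′ v (A *ᵥ w′) ⟩
        n * bilinear A y′ w′ + (- a) * bilinear A v w′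
          ≈⟨ +-cong (*-congˡ (trans (bilinear-sym A-sym y′ w′) (∙-linear₂ n (- a) y′ v (A *ᵥ y′))))
               (*-congˡ (trans (bilinear-sym A-sym v w′) (trans (bilinear-v w′) (*-congˡ (∙-linear₂ n
                   (- a) y′ v v))))) ⟩
        n * (n * bilinear A y′ y′ + (- a) * bilinear A v y′) + (- a) * (l * (n * (y′ ∙ v) + (- a) * n))
          ≈⟨ +-cong (*-congˡ (+-congˡ (*-congˡ (trans (bilinear-sym A-sym v y′) (trans (bilinear-v y′)
              (*-congˡ (y∙v≈α ω)))))))
               (*-congˡ (*-congˡ (+-congʳ (*-congˡ (y∙v≈α ω))))) ⟩
        n * (n * bilinear A y′ y′ + (- a) * (l * a)) + (- a) * (l * (n * a + (- a) * n))
          ≈⟨ solve 4 (λ n a l B → n :* (n :* B :+ (:- a) :* (l :* a)) :+ (:- a) :* (l :* (n :* a :+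
              (:- a) :* n))
               := n :* n :* B :- n :* l :* (a :* a)) refl n a l (bilinear A y′ y′) ⟩
        n * n * bilinear A y′ y′ - n * l * (a * a) ∎
        where
        open import Relation.Binary.Reasoning.Setoid setoid
        a = α ω
        y′ = y ω
        w′ = w ω

      -- Arises from the singular value expansion of `2 wᵀAw` by `2 p q ≤ p² + q²`. It is
      -- nonnegative, as Markov's inequality demands, and its mean involves only second moments of
      -- `u ∙ w` for unit vectors `u`.
      energy : Ω → ℝ
      energy ω = sum (λ m → σ m * ((column P m ∙ w ω) * (column P m ∙ w ω) +
                                   (column Q m ∙ w ω) * (column Q m ∙ w ω)))

      energy-nonneg : ∀ ω → 0# ≤ energy ω
      energy-nonneg ω = sum-nonneg (λ m → *-nonneg (0≤σ m) (+-nonneg (square-nonneg _) (square-nonneg _)))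

      2bilinear≤energy : ∀ ω → fromℕ 2 * bilinear A (w ω) (w ω) ≤ energy ω
      2bilinear≤energy ω = begin
        fromℕ 2 * bilinear A (w ω) (w ω)
          ≈⟨ *-congˡ (bilinear-SVD {A = A} {P} {Q} {σ} A≈ (w ω)) ⟩
        fromℕ 2 * sum (λ m → σ m * q m * p m)
          ≈⟨ *-distribˡ-sum (fromℕ 2) (λ m → σ m * q m * p m) ⟩
        sum (λ m → fromℕ 2 * (σ m * q m * p m))
          ≤⟨ sum-mono-≤ (λ m → ≤-gap (σ m * ((p m - q m) * (p m - q m)))
               (solve 3 (λ s p q → s :* (p :* p :+ q :* q)
                   := :ℕ 2 :* (s :* q :* p) :+ s :* ((p :- q) :* (p :- q)))
                 refl (σ m) (p m) (q m))
               (*-nonneg (0≤σ m) (square-nonneg (p m - q m)))) ⟩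
        energy ω ∎
        where
        open ≤-R
        p q : Vector ℝ d
        p m = column P m ∙ w ω
        q m = column Q m ∙ w ω

      module _ (u : Vector ℝ d) where
        -- This is `n` times the component of `u` orthogonal to `v`. Moving the projection from the
        -- random `y` to the fixed `u` turns `u ∙ w` into a sum of `k` independent copies of `h`.
        ũ : Vector ℝ d
        ũ i = n * u i + (- (u ∙ v)) * v i

        h : Vec Bool d → ℝ
        h g = (signs g ∙ ũ) * (signs g ∙ v)

        ũ∙v≈0 : ũ ∙ v ≈ 0#
        ũ∙v≈0 = trans (∙-linear₂ n (- (u ∙ v)) u v v)
          (solve 2 (λ n c → n :* c :+ (:- c) :* n := :0) refl n (u ∙ v))

        -- Orthogonality to `v` gives `ũ ∙ ũ = n * (u ∙ ũ) = n * (n - (u ∙ v)²)`.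
        ũ∙ũ≤ : u ∙ u ≈ 1# → ũ ∙ ũ ≤ n * n
        ũ∙ũ≤ u∙u≈1 = ≤-gap (n * (c * c)) (begin
          n * n
            ≈⟨ solve 2 (λ n c → n :* n := n :* (n :* :1 :+ (:- c) :* c) :+ n :* (c :* c)) refl n c ⟩
          n * (n * 1# + (- c) * c) + n * (c * c)
            ≈⟨ +-congʳ (*-congˡ (+-congʳ (*-congˡ (sym u∙u≈1)))) ⟩
          n * (n * (u ∙ u) + (- c) * c) + n * (c * c)
            ≈⟨ +-congʳ (*-congˡ (trans (+-congˡ (*-congˡ (∙-comm u v))) (sym (∙-linear₂ n
                (- c) u v u)))) ⟩
          n * (ũ ∙ u) + n * (c * c)
            ≈⟨ +-congʳ (trans (sym (+-identityʳ _)) (+-cong (*-congˡ (∙-comm ũ u))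
                 (trans (sym (zeroʳ (- c))) (*-congˡ (trans (sym ũ∙v≈0) (∙-comm ũ v)))))) ⟩
          n * (u ∙ ũ) + (- c) * (v ∙ ũ) + n * (c * c)
            ≈⟨ +-congʳ (∙-linear₂ n (- c) u v ũ) ⟨
          ũ ∙ ũ + n * (c * c) ∎) (*-nonneg (proj₁ 0<n) (square-nonneg c))
          where
          open import Relation.Binary.Reasoning.Setoid setoid
          c = u ∙ v

        𝔼h≈0 : Signs.𝔼 d h ≈ 0#
        𝔼h≈0 = trans (𝔼-signs² ũ v) ũ∙v≈0

        -- The mixed term of `𝔼-signs⁴` vanishes because `ũ` is orthogonal to `v`.
        𝔼h²≤ : u ∙ u ≈ 1# → Signs.𝔼 d (λ g → h g * h g) ≤ n * n * n
        𝔼h²≤ u∙u≈1 = begin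
          Signs.𝔼 d (λ g → h g * h g)                             ≤⟨ 𝔼-signs⁴ ũ v ⟩
          (ũ ∙ ũ) * n + fromℕ 2 * ((ũ ∙ v) * (ũ ∙ v))
            ≈⟨ +-congˡ (*-congˡ (*-congʳ ũ∙v≈0)) ⟩
          (ũ ∙ ũ) * n + fromℕ 2 * (0# * (ũ ∙ v))
            ≈⟨ solve 2 (λ a b → a :+ :ℕ 2 :* (:0 :* b) := a) refl _ (ũ ∙ v) ⟩
          (ũ ∙ ũ) * n
            ≤⟨ *-monoʳ-≤ (proj₁ 0<n) (ũ∙ũ≤ u∙u≈1) ⟩
          n * n * n                                               ∎
          where open ≤-R

        u∙w≈ : ∀ ω → u ∙ w ω ≈ sum (λ j → h (lookup ω j))
        u∙w≈ ω = begin
          u ∙ w ω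
            ≈⟨ trans (∙-comm u (w ω)) (∙-linear₂ n (- α ω) (y ω) v u) ⟩
          n * (y ω ∙ u) + (- α ω) * (v ∙ u)
            ≈⟨ +-cong (*-congˡ (combination-∙ (x ω) (G ω) u))
                 (trans (solve 2 (λ a c → (:- a) :* c := (:- c) :* a)
                     refl (α ω) (v ∙ u)) (*-congʳ (-‿cong (∙-comm v u)))) ⟩
          n * sum (λ j → x ω j * (G ω j ∙ u)) + (- (u ∙ v)) * sum (λ j → x ω j * x ω j)
            ≈⟨ +-cong (*-distribˡ-sum n (λ j → x ω j * (G ω j ∙ u))) (*-distribˡ-sum (- (u ∙ v)) (λ j
                → x ω j * x ω j)) ⟩
          sum (λ j → n * (x ω j * (G ω j ∙ u))) + sum (λ j → (- (u ∙ v)) * (x ω j * x ω j))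
            ≈⟨ ∑-distrib-+ (λ j → n * (x ω j * (G ω j ∙ u))) (λ j → (- (u ∙ v)) * (x ω j * x ω j)) ⟨
          sum (λ j → n * (x ω j * (G ω j ∙ u)) + (- (u ∙ v)) * (x ω j * x ω j))
            ≈⟨ sum-cong-≋ (λ j → trans
                 (solve 4 (λ n x g c → n :* (x :* g) :+ (:- c) :* (x :* x)
                     := (n :* g :+ (:- c) :* x) :* x) refl n (x ω j) (G ω j ∙ u) (u ∙ v))
                 (*-congʳ (trans (+-cong (*-congˡ (∙-comm (G ω j) u)) (*-congˡ (∙-comm (G ω j) v)))
                   (trans (sym (∙-linear₂ n (- (u ∙ v)) u v (G ω j))) (∙-comm ũ (G ω j)))))) ⟩
          sum (λ j → h (lookup ω j)) ∎
          where open import Relation.Binary.Reasoning.Setoid setoid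

        𝔼[u∙w]² : u ∙ u ≈ 1# → 𝔼 (λ ω → (u ∙ w ω) * (u ∙ w ω)) ≤ κ * (n * n * n)
        𝔼[u∙w]² u∙u≈1 = ≤-trans (≤-reflexive (𝔼-cong (λ ω → *-cong (u∙w≈ ω) (u∙w≈ ω))))
          (variance-total (coins d) h 𝔼h≈0 (𝔼h²≤ u∙u≈1) k)

      𝔼-energy : 𝔼 energy ≤ S * (fromℕ 2 * (κ * (n * n * n)))
      𝔼-energy = begin
        𝔼 energy
          ≈⟨ 𝔼-sum (λ m ω → σ m * (p m ω * p m ω + q m ω * q m ω)) ⟩
        sum (λ m → 𝔼 (λ ω → σ m * (p m ω * p m ω + q m ω * q m ω)))
          ≤⟨ sum-mono-≤ (λ m → ≤-trans (≤-reflexive (trans (𝔼-* (σ m) _) (*-congˡ (𝔼-+ _ _))))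
               (*-monoˡ-≤ (0≤σ m) (≤-trans (+-mono-≤ (𝔼[u∙w]² (column P m) (column-norm {P = P} P-orth m))
                 (𝔼[u∙w]² (column Q m) (column-norm {P = Q} Q-orth m)))
                 (≤-reflexive (solve 1 (λ c → c :+ c := :ℕ 2 :* c) refl (κ * (n * n * n))))))) ⟩
        sum (λ m → σ m * (fromℕ 2 * (κ * (n * n * n))))
          ≈⟨ *-distribʳ-sum (fromℕ 2 * (κ * (n * n * n))) σ ⟨
        S * (fromℕ 2 * (κ * (n * n * n))) ∎
        where
        open ≤-R
        p q : Fin d → Ω → ℝ
        p m ω = column P m ∙ w ω
        q m ω = column Q m ∙ w ω

      h₀ : Vec Bool d → ℝ
      h₀ g = (signs g ∙ v) * (signs g ∙ v) + - n

      𝔼h₀≈0 : Signs.𝔼 d h₀ ≈ 0#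
      𝔼h₀≈0 = begin
        Signs.𝔼 d h₀                         ≈⟨ Signs.𝔼-+ d _ _ ⟩
        _                                    ≈⟨ +-cong (𝔼-signs² v v) (Signs.𝔼-const d (- n)) ⟩
        n + - n                              ≈⟨ -‿inverseʳ n ⟩
        0#                                   ∎
        where open import Relation.Binary.Reasoning.Setoid setoid

      -- The fourth moment of `signs g ∙ v` is at most `3 n²`, and the squared mean `n²` of its
      -- square is subtracted.
      𝔼h₀²≤ : Signs.𝔼 d (λ g → h₀ g * h₀ g) ≤ fromℕ 2 * (n * n)
      𝔼h₀²≤ = begin
        Signs.𝔼 d (λ g → h₀ g * h₀ g)
          ≈⟨ Signs.𝔼-cong d (λ g → solve 2 (λ x n → (x :+ :- n) :* (x :+ :- n)
              := x :* x :+ ((:- (:ℕ 2 :* n)) :* x :+ n :* n))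
               refl ((signs g ∙ v) * (signs g ∙ v)) n) ⟩
        Signs.𝔼 d (λ g → _ + ((- (fromℕ 2 * n)) * ((signs g ∙ v) * (signs g ∙ v)) + n * n))
          ≈⟨ trans (Signs.𝔼-+ d _ _) (+-congˡ (trans (Signs.𝔼-+ d _ _) (+-cong
               (trans (Signs.𝔼-* d _ _) (*-congˡ (𝔼-signs² v v))) (Signs.𝔼-const d _)))) ⟩
        Signs.𝔼 d (λ g → (signs g ∙ v) * (signs g ∙ v) * ((signs g ∙ v) * (signs g ∙ v)))
          + ((- (fromℕ 2 * n)) * n + n * n)
          ≤⟨ +-monoˡ-≤ _ (𝔼-signs⁴ v v) ⟩
        n * n + fromℕ 2 * (n * n) + ((- (fromℕ 2 * n)) * n + n * n)
          ≈⟨ solve 1 (λ n → n :* n :+ :ℕ 2 :* (n :* n) :+ ((:- (:ℕ 2 :* n)) :* n :+ n :* n)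
              := :ℕ 2 :* (n :* n)) refl n ⟩
        fromℕ 2 * (n * n) ∎
        where open ≤-R

      α-κn≈ : ∀ ω → α ω - κ * n ≈ sum (λ j → h₀ (lookup ω j))
      α-κn≈ ω = begin
        α ω - κ * n
          ≈⟨ +-congˡ (solve 2 (λ k n → :- (k :* n) := k :* (:- n)) refl κ n) ⟩
        α ω + κ * (- n)                                     ≈⟨ +-congˡ (sum-const k) ⟨
        sum (λ j → x ω j * x ω j) + sum {k} (λ _ → - n)
          ≈⟨ ∑-distrib-+ (λ j → x ω j * x ω j) (λ _ → - n) ⟨
        sum (λ j → h₀ (lookup ω j))                         ∎
        where open import Relation.Binary.Reasoning.Setoid setoid

      𝔼[α-κn]² : 𝔼 (λ ω → (α ω - κ * n) * (α ω - κ * n)) ≤ κ * (fromℕ 2 * (n * n))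
      𝔼[α-κn]² = ≤-trans (≤-reflexive (𝔼-cong (λ ω → *-cong (α-κn≈ ω) (α-κn≈ ω))))
        (variance-total (coins d) h₀ 𝔼h₀≈0 𝔼h₀²≤ k)

      -- Acceptance makes the form nonnegative at `y`, so by `bilinear-w` the part `w` must
      -- compensate the negative contribution of `v`.
      accepted⇒ : ∀ ω → output A ω ≡ true → fromℕ 2 * (n * e * (α ω * α ω)) ≤ energy ω
      accepted⇒ ω accepted = begin
        fromℕ 2 * (n * e * (α ω * α ω))
          ≤⟨ *-monoˡ-≤ (fromℕ-nonneg 2) (*-monoʳ-≤ (square-nonneg (α ω)) (*-monoˡ-≤ (proj₁ 0<n) e≤-l)) ⟩
        fromℕ 2 * (n * (- l) * (α ω * α ω))
          ≤⟨ *-monoˡ-≤ (fromℕ-nonneg 2) (≤-gap (n * n * B)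
               (solve 4 (λ n l a B → n :* n :* B :- n :* l :* (a :* a)
                   := n :* (:- l) :* (a :* a) :+ n :* n :* B) refl n l (α ω) B)
               (*-nonneg (square-nonneg n) (accepted⇒nonneg A-sym ω (x ω) accepted))) ⟩
        fromℕ 2 * (n * n * B - n * l * (α ω * α ω))
          ≈⟨ *-congˡ (bilinear-w ω) ⟨
        fromℕ 2 * bilinear A (w ω) (w ω)
          ≤⟨ 2bilinear≤energy ω ⟩
        energy ω ∎
        where
        open ≤-R
        B = bilinear A (y ω) (y ω)
        e≤-l : e ≤ - l
        e≤-l = ≤-trans (≤-reflexive (solve 1 (λ e → e := :- (:- e)) refl e)) (neg-mono-≤ l≤-e)

      0≤ne : 0# ≤ n * e
      0≤ne = *-nonneg (proj₁ 0<n) (proj₁ 0<e)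

      -- Chebyshev's and Markov's inequalities at once.
      markov : ∀ ω → κ * n * (κ * n) * (n * e) * indicator (Outputs A true ω)
                       ≤ fromℕ 2 * (n * e) * ((α ω - κ * n) * (α ω - κ * n)) + energy ω
      markov ω = by-output (em {Outputs A true ω})
        where
        open ≤-R
        K = κ * n
        a = α ω
        0≤square = *-nonneg (*-nonneg (fromℕ-nonneg 2) 0≤ne) (square-nonneg (a - K))
        by-output : Dec (Outputs A true ω) → _
        by-output (yes accepted) = begin
          K * K * (n * e) * indicator (Outputs A true ω)
            ≈⟨ trans (*-congˡ (indicator-yes accepted)) (*-identityʳ _) ⟩
          K * K * (n * e)
            ≤⟨ ≤-gap ((n * e) * ((a + a - K) * (a + a - K)))
                 (solve 3 (λ K c a → :ℕ 2 :* c :* ((a :- K) :* (a :- K)) :+ :ℕ 2 :* (c :* (a :* a))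
                   := K :* K :* c :+ c :* ((a :+ a :- K) :* (a :+ a :- K))) refl K (n * e) a)
                 (*-nonneg 0≤ne (square-nonneg _)) ⟩
          fromℕ 2 * (n * e) * ((a - K) * (a - K)) + fromℕ 2 * (n * e * (a * a))
            ≤⟨ +-monoʳ-≤ _ (accepted⇒ ω accepted) ⟩
          fromℕ 2 * (n * e) * ((a - K) * (a - K)) + energy ω ∎
        by-output (no rejected) = begin
          K * K * (n * e) * indicator (Outputs A true ω)
            ≈⟨ trans (*-congˡ (indicator-no rejected)) (zeroʳ _) ⟩
          0#
            ≤⟨ +-nonneg 0≤square (energy-nonneg ω) ⟩
          fromℕ 2 * (n * e) * ((a - K) * (a - K)) + energy ω ∎

      ℙ-accept : ℝ
      ℙ-accept = ℙ average (Outputs A true)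

      -- The mean of `markov` with the common factor `κ n³` cancelled. The deviation of `α` from its
      -- mean accounts for `4 e`, the energy for `2 S`.
      ℙ-accept-bound : 0# < κ → κ * e * ℙ-accept ≤ fromℕ 4 * e + fromℕ 2 * S
      ℙ-accept-bound 0<κ = *-cancelˡ-≤ (*-pos 0<κ (*-pos (*-pos 0<n 0<n) 0<n)) (begin
        κ * (n * n * n) * (κ * e * ℙ-accept)
          ≈⟨ solve 4 (λ k n e p → k :* (n :* n :* n) :* (k :* e :* p)
              := k :* n :* (k :* n) :* (n :* e) :* p) refl κ n e ℙ-accept ⟩
        κ * n * (κ * n) * (n * e) * ℙ-accept
          ≈⟨ 𝔼-* _ _ ⟨
        𝔼 (λ ω → κ * n * (κ * n) * (n * e) * indicator (Outputs A true ω))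
          ≤⟨ 𝔼-mono markov ⟩
        𝔼 (λ ω → fromℕ 2 * (n * e) * ((α ω - κ * n) * (α ω - κ * n)) + energy ω)
          ≈⟨ trans (𝔼-+ _ _) (+-congʳ (𝔼-* _ _)) ⟩
        fromℕ 2 * (n * e) * 𝔼 (λ ω → (α ω - κ * n) * (α ω - κ * n)) + 𝔼 energy
          ≤⟨ +-mono-≤ (*-monoˡ-≤ (*-nonneg (fromℕ-nonneg 2) 0≤ne) 𝔼[α-κn]²) 𝔼-energy ⟩
        fromℕ 2 * (n * e) * (κ * (fromℕ 2 * (n * n))) + S * (fromℕ 2 * (κ * (n * n * n)))
          ≈⟨ solve 4 (λ k n e S → :ℕ 2 :* (n :* e) :* (k :* (:ℕ 2 :* (n :* n))) :+ S :* (:ℕ 2 :* (k :*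
              (n :* n :* n)))
               := k :* (n :* n :* n) :* (:ℕ 4 :* e :+ :ℕ 2 :* S)) refl κ n e S ⟩
        κ * (n * n * n) * (fromℕ 4 * e + fromℕ 2 * S) ∎)
        where open ≤-R

      -- Acceptance has probability at most `4 / κ + 2 S / (κ e)`; the two thresholds make each
      -- summand at most 1/6.
      3ℙ-accept≤1 : fromℕ 24 ≤ κ → fromℕ 12 * S ≤ κ * e → fromℕ 3 * ℙ-accept ≤ 1#
      3ℙ-accept≤1 24≤κ 12S≤κe = *-cancelˡ-≤ (*-pos (0<fromℕ-suc 1) (*-pos 0<κ 0<e)) (begin
        fromℕ 2 * (κ * e) * (fromℕ 3 * ℙ-accept)
          ≈⟨ solve 2 (λ c p → :ℕ 2 :* c :* (:ℕ 3 :* p) := :ℕ 6 :* (c :* p)) refl (κ * e) ℙ-accept ⟩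
        fromℕ 6 * (κ * e * ℙ-accept)
          ≤⟨ *-monoˡ-≤ (fromℕ-nonneg 6) (ℙ-accept-bound 0<κ) ⟩
        fromℕ 6 * (fromℕ 4 * e + fromℕ 2 * S)
          ≈⟨ solve 2 (λ e S → :ℕ 6 :* (:ℕ 4 :* e :+ :ℕ 2 :* S) := :ℕ 24 :* e :+ :ℕ 12 :* S) refl e S ⟩
        fromℕ 24 * e + fromℕ 12 * S
          ≤⟨ +-mono-≤ (*-monoʳ-≤ (proj₁ 0<e) 24≤κ) 12S≤κe ⟩
        κ * e + κ * e
          ≈⟨ solve 1 (λ c → c :+ c := :ℕ 2 :* c :* :1) refl (κ * e) ⟩
        fromℕ 2 * (κ * e) * 1# ∎)
        where
        open ≤-R
        0<κ : 0# < κ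
        0<κ = <-≤-trans (0<fromℕ-suc 23) 24≤κ

      ℙ-reject : fromℕ 24 ≤ κ → fromℕ 12 * S ≤ κ * e →
        fromℕ 2 * fromℕ 3 ⁻¹ ≤ ℙ average (Outputs A false)
      ℙ-reject 24≤κ 12S≤κe = *-cancelˡ-≤ (0<fromℕ-suc 2) (begin
        fromℕ 3 * (fromℕ 2 * fromℕ 3 ⁻¹)
          ≈⟨ *-⁻¹-cancel (fromℕ 2) (0<fromℕ-suc 2) ⟩
        fromℕ 2
          ≈⟨ solve 0 (:ℕ 2 := :ℕ 3 :* :1 :- :1) refl ⟩
        fromℕ 3 * 1# - 1#
          ≤⟨ +-monoʳ-≤ _ (neg-mono-≤ (3ℙ-accept≤1 24≤κ 12S≤κe)) ⟩
        fromℕ 3 * 1# - fromℕ 3 * ℙ-accept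
          ≈⟨ +-congʳ (*-congˡ (ℙ-true+ℙ-false A)) ⟨
        fromℕ 3 * (ℙ-accept + ℙ-false) - fromℕ 3 * ℙ-accept
          ≈⟨ solve 2 (λ p q → :ℕ 3 :* (p :+ q) :- :ℕ 3 :* p := :ℕ 3 :* q) refl ℙ-accept ℙ-false ⟩
        fromℕ 3 * ℙ-false ∎)
        where
        open ≤-R
        ℙ-false = ℙ average (Outputs A false)

-- Choice of the number of sign vectors.

module Testers (em : ExcludedMiddle 0ℓ) (R : RealNumbers) where

  open Testing R
  open RingSolver R
  open OrderedField em R
  open NormBounds em R
  open FiniteProbability em R
  open Sketching em R
  open import Algebra.Properties.CommutativeMonoid.Sum +-commutativeMonoid using (sum-cong-≋)
  open Solver

  square-cancel-≤ : ∀ {x y} → 0# ≤ y → x * x ≤ y * y → x ≤ y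
  square-cancel-≤ {x} {y} 0≤y x²≤y² = ^-cancel-≤ 2 (s≤s z≤n) 0≤y (begin
    x ^ 2    ≈⟨ *-congˡ (*-identityʳ x) ⟩
    x * x    ≤⟨ x²≤y² ⟩
    y * y    ≈⟨ *-congˡ (*-identityʳ y) ⟨
    y ^ 2    ∎)
    where open ≤-R

  -- Replaces rounding up a square root. The search ends at `m + 1` with `m² ≤ x`, and
  -- `(m + 1)² ≤ 2 m² + 2 ≤ 4 x` since `1 ≤ x`.
  nearby-square : ∀ {x} → 1# ≤ x →
    Σ[ k ∈ ℕ ] x ≤ fromℕ k * fromℕ k × fromℕ k * fromℕ k ≤ fromℕ 4 * x
  nearby-square {x} 1≤x = search N (begin
      x                    ≤⟨ proj₂ (archimedean x) ⟩
      fromℕ N              ≈⟨ *-identityˡ _ ⟨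
      1# * fromℕ N         ≤⟨ *-monoʳ-≤ (fromℕ-nonneg N) (≤-trans 1≤x (proj₂ (archimedean x))) ⟩
      fromℕ N * fromℕ N    ∎)
    where
    open ≤-R
    N = proj₁ (archimedean x)
    Nearby : Set
    Nearby = Σ[ k ∈ ℕ ] x ≤ fromℕ k * fromℕ k × fromℕ k * fromℕ k ≤ fromℕ 4 * x
    search : ∀ n → x ≤ fromℕ n * fromℕ n → Nearby
    search zero    x≤0 = contradiction (≤-trans x≤0 (≤-reflexive (zeroˡ 0#))) (<⇒≱ (<-≤-trans 0<1 1≤x))
    search (suc n) x≤  = step (total x (fromℕ n * fromℕ n))
      where
      m = fromℕ n
      step : x ≤ m * m ⊎ m * m ≤ x → Nearby
      step (inj₁ x≤m²) = search n x≤m²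
      step (inj₂ m²≤x) = suc n , x≤ , (begin
        (1# + m) * (1# + m)                ≤⟨ ≤-gap ((1# - m) * (1# - m))
          (solve 1 (λ m → :ℕ 2 :* (m :* m) :+ :ℕ 2 :* :1
              := (:1 :+ m) :* (:1 :+ m) :+ (:1 :- m) :* (:1 :- m)) refl m)
          (square-nonneg (1# - m)) ⟩
        fromℕ 2 * (m * m) + fromℕ 2 * 1#
          ≤⟨ +-mono-≤ (*-monoˡ-≤ (fromℕ-nonneg 2) m²≤x) (*-monoˡ-≤ (fromℕ-nonneg 2) 1≤x) ⟩
        fromℕ 2 * x + fromℕ 2 * x
          ≈⟨ solve 1 (λ x → :ℕ 2 :* x :+ :ℕ 2 :* x := :ℕ 4 :* x) refl x ⟩
        fromℕ 4 * x                        ∎)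

  -- Makes `e = ε s` strictly positive. If the norm vanished, the norm comparison would annihilate
  -- the sum of the singular values, and with it `A`.
  Schatten-pos : ∀ {d} → 1 ℕ.≤ d → ∀ p {A : Matrix d} {s} → ¬ IsZero A → IsSchattenNorm p A s → 0# < s
  Schatten-pos {d} 1≤d p {A} {s} A≉0 (σ , (0≤σ , P , Q , _ , _ , A≈) , s≈) =
    ≤-trans (ℓ-norm-nonneg 1≤d p σ 0≤σ) (≤-reflexive (sym s≈)) , λ 0≈s → A≉0 (A≈0 (trans (sym s≈) (sym 0≈s)))
    where
    open ≤-R
    module _ (ℓ≈0 : ℓ-norm p σ ≈ 0#) where
      S≈0 : sum σ ≤ 0#
      S≈0 = square-cancel-≤ ≤-refl (begin
        sum σ * sum σ
          ≤⟨ sum²≤ℓ-norm² 1≤d p σ 0≤σ ⟩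
        fromℕ 16 * ℓ-norm p σ * (fromℕ 16 * ℓ-norm p σ) * dimensionFactor d p
          ≈⟨ *-congʳ (*-cong (*-congˡ ℓ≈0) (*-congˡ ℓ≈0)) ⟩
        fromℕ 16 * 0# * (fromℕ 16 * 0#) * dimensionFactor d p
          ≈⟨ solve 1 (λ D → :ℕ 16 :* :0 :* (:ℕ 16 :* :0) :* D := :0 :* :0) refl (dimensionFactor d p) ⟩
        0# * 0# ∎)
      σ≈0 : ∀ m → σ m ≈ 0#
      σ≈0 m = ≤-antisym (≤-trans (term≤sum 0≤σ m) S≈0) (0≤σ m)
      A≈0 : IsZero A
      A≈0 i j = begin-equality
        A i j                               ≈⟨ A≈ i j ⟩
        sum (λ m → P i m * σ m * Q j m)
          ≈⟨ sum-cong-≋ (λ m → trans (*-congʳ (trans (*-congˡ (σ≈0 m)) (zeroʳ _))) (zeroˡ _)) ⟩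
        sum {d} (λ m → 0#)                  ≈⟨ trans (sum-const d) (zeroʳ _) ⟩
        0#                                  ∎

  -- `192 = 12 * 16`, where 12 is the threshold in `3ℙ-accept≤1` and 16 the constant of
  -- `sum²≤ℓ-norm²`.
  K² : ℝ
  K² = fromℕ 192 * fromℕ 192

  module Tester {d : ℕ} (1≤d : 1 ℕ.≤ d) (p : Exponent) {ε : ℝ} (0<ε : 0# < ε) (ε<1 : ε < 1#) where

    D i X : ℝ
    D = dimensionFactor d p
    i = (ε ^ 2) ⁻¹
    X = K² * i * D

    0<ε² : 0# < ε ^ 2
    0<ε² = ^-pos 0<ε 2

    0<i : 0# < i
    0<i = ⁻¹-pos 0<ε²

    ε²i≈1 : ε ^ 2 * i ≈ 1#
    ε²i≈1 = ⁻¹-inverseʳ (ε ^ 2) (pos⇒≉0 0<ε²)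

    0≤K² : 0# ≤ K²
    0≤K² = square-nonneg (fromℕ 192)

    -- Forces `κ ≥ 192`, which covers the other threshold, 24, for all `d`, `p` and `ε`.
    K²≤X : K² ≤ X
    K²≤X = begin
      K²               ≈⟨ solve 1 (λ K → K := K :* :1 :* :1) refl K² ⟩
      K² * 1# * 1#
        ≤⟨ *-mono-≤ (*-nonneg 0≤K² 0≤1) 0≤1 (*-monoˡ-≤ 0≤K² 1≤i) (1≤dimensionFactor 1≤d p) ⟩
      X                ∎
      where
      open ≤-R
      1≤i : 1# ≤ i
      1≤i = begin
        1#           ≈⟨ ε²i≈1 ⟨
        ε ^ 2 * i    ≤⟨ *-monoʳ-≤ (proj₁ 0<i) (^≤1 (proj₁ 0<ε) (proj₁ ε<1) 2) ⟩
        1# * i       ≈⟨ *-identityˡ i ⟩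
        i            ∎

    1≤192 : 1# ≤ fromℕ 192
    1≤192 = 1≤fromℕ {192} (s≤s z≤n)

    nearby : Σ[ k ∈ ℕ ] X ≤ fromℕ k * fromℕ k × fromℕ k * fromℕ k ≤ fromℕ 4 * X
    nearby = nearby-square (≤-trans (≤-trans (≤-reflexive (sym (*-identityˡ 1#)))
      (*-mono-≤ 0≤1 0≤1 1≤192 1≤192)) K²≤X)

    k : ℕ
    k = proj₁ nearby

    κ : ℝ
    κ = fromℕ k

    X≤κ² : X ≤ κ * κ
    X≤κ² = proj₁ (proj₂ nearby)

    open Sketch d k

    24≤κ : fromℕ 24 ≤ κ
    24≤κ = ≤-trans (fromℕ-mono-≤ {24} {192} (ℕ.m≤m+n 24 168))
      (square-cancel-≤ (fromℕ-nonneg k) (≤-trans K²≤X X≤κ²))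

    12S≤κεs : ∀ {A : Matrix d} {s} (norm : IsSchattenNorm p A s) →
      fromℕ 12 * sum (proj₁ norm) ≤ κ * (ε * s)
    12S≤κεs {s = s} (σ , (0≤σ , _) , s≈) =
      square-cancel-≤ (*-nonneg (fromℕ-nonneg k) (*-nonneg (proj₁ 0<ε) 0≤s)) (begin
      fromℕ 12 * S * (fromℕ 12 * S)
        ≈⟨ solve 2 (λ c S → c :* S :* (c :* S) := c :* c :* (S :* S)) refl (fromℕ 12) S ⟩
      fromℕ 12 * fromℕ 12 * (S * S)
        ≤⟨ *-monoˡ-≤ (square-nonneg (fromℕ 12)) (sum²≤ℓ-norm² 1≤d p σ 0≤σ) ⟩
      fromℕ 12 * fromℕ 12 * (fromℕ 16 * ℓ-norm p σ * (fromℕ 16 * ℓ-norm p σ) * D)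
        ≈⟨ *-congˡ (*-congʳ (*-cong (*-congˡ s≈) (*-congˡ s≈))) ⟨
      fromℕ 12 * fromℕ 12 * (fromℕ 16 * s * (fromℕ 16 * s) * D)
        ≈⟨ solve 4 (λ a b s D → a :* a :* (b :* s :* (b :* s) :* D)
            := a :* b :* (a :* b) :* :1 :* D :* (s :* s))
             refl (fromℕ 12) (fromℕ 16) s D ⟩
      fromℕ 12 * fromℕ 16 * (fromℕ 12 * fromℕ 16) * 1# * D * (s * s)
        ≈⟨ *-congʳ (*-congʳ (*-cong (*-cong (fromℕ-* 12 16) (fromℕ-* 12 16)) ε²i≈1)) ⟨
      K² * (ε ^ 2 * i) * D * (s * s)
        ≈⟨ solve 5 (λ K e i D s → K :* (e :^ 2 :* i) :* D :* (s :* s)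
            := K :* i :* D :* (e :* s :* (e :* s))) refl K² ε i D s ⟩
      X * (ε * s * (ε * s))
        ≤⟨ *-monoʳ-≤ (square-nonneg (ε * s)) X≤κ² ⟩
      κ * κ * (ε * s * (ε * s))
        ≈⟨ solve 2 (λ k e → k :* k :* (e :* e) := k :* e :* (k :* e)) refl κ (ε * s) ⟩
      κ * (ε * s) * (κ * (ε * s)) ∎)
      where
      open ≤-R
      S = sum σ
      0≤s : 0# ≤ s
      0≤s = ≤-trans (ℓ-norm-nonneg 1≤d p σ 0≤σ) (≤-reflexive (sym s≈))

    2/3≤1 : fromℕ 2 * fromℕ 3 ⁻¹ ≤ 1#
    2/3≤1 = *-cancelˡ-≤ (0<fromℕ-suc 2) (begin
      fromℕ 3 * (fromℕ 2 * fromℕ 3 ⁻¹)   ≈⟨ *-⁻¹-cancel (fromℕ 2) (0<fromℕ-suc 2) ⟩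
      fromℕ 2                            ≤⟨ fromℕ-mono-≤ {2} {3} (ℕ.n≤1+n 2) ⟩
      fromℕ 3                            ≈⟨ *-identityʳ _ ⟨
      fromℕ 3 * 1#                       ∎)
      where open ≤-R

    oneSided : IsOneSided sketch
    oneSided A A-sym A-psd ω = output-PSD {A} A-sym A-psd ω

    isTester : IsTester sketch ε p
    isTester = record
      { accepts-PSD = λ A A-sym A-psd → ≤-trans 2/3≤1 (≤-reflexive (sym
          (trans (𝔼-cong (λ ω → indicator-yes (oneSided A A-sym A-psd ω))) 𝔼-1)))
      ; rejects-far = λ { A A-sym A≉0 l s ((v , v≉0 , Av≋lv) , _)
          norm@(σ , (0≤σ , P , Q , P-orth , Q-orth , A≈) , _) l≤ →
          Far.ℙ-reject {P = P} {Q} {σ} A-sym Av≋lv v≉0 0≤σ P-orth Q-orth A≈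
            (*-pos 0<ε (Schatten-pos 1≤d p A≉0 norm)) l≤ 24≤κ (12S≤κεs {A} norm) }
      }
      where open FiniteAverage average

    makesAtMost : MakesAtMost sketch (fromℕ 4 * K² * i * D)
    makesAtMost _ = begin
      fromℕ (k ℕ.* k)          ≈⟨ fromℕ-* k k ⟩
      κ * κ                    ≤⟨ proj₂ (proj₂ nearby) ⟩
      fromℕ 4 * X
        ≈⟨ solve 4 (λ c K i D → c :* (K :* i :* D) := c :* K :* i :* D) refl (fromℕ 4) K² i D ⟩
      fromℕ 4 * K² * i * D     ∎
      where open ≤-R

  tester-exists : Σ[ C ∈ ℝ ] 0# < C ×
        ((d : ℕ) → 1 ℕ.≤ d → (p : Exponent) → (ε : ℝ) → 0# < ε → ε < 1# →
          Σ[ T ∈ NonAdaptiveAlgorithm d ]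
            IsTester T ε p ×
            IsOneSided T ×
            MakesAtMost T
              (C * (ε ^ 2) ⁻¹ * fromℕ d ^ʳ (fromℕ 2 - fromℕ 2 * recip p)))
  -- The 4 is the loss in `nearby-square`.
  tester-exists = fromℕ 4 * K² , *-pos (0<fromℕ-suc 3) (*-pos (0<fromℕ-suc 191) (0<fromℕ-suc 191)) ,
    λ d 1≤d p ε 0<ε ε<1 → let open Tester 1≤d p 0<ε ε<1 in
      Sketch.sketch d k , isTester , oneSided , makesAtMost

corollary42 : ExcludedMiddle 0ℓ → (R : RealNumbers) → let open Testing R in
    Σ[ C ∈ ℝ ] 0# < C ×
    ((d : ℕ) → 1 ℕ.≤ d → (p : Exponent) → (ε : ℝ) → 0# < ε → ε < 1# →
    Σ[ T ∈ NonAdaptiveAlgorithm d ]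
    IsTester T ε p ×
    IsOneSided T ×
    MakesAtMost T
    (C * (ε ^ 2) ⁻¹ * fromℕ d ^ʳ (fromℕ 2 - fromℕ 2 * recip p)))
corollary42 = Testers.tester-exists
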